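{- Let $d\ge 2$ be a fixed integer. If $D$ is a sourceless digraph with $n$ vertices, maximum out-degree $\Delta^+(D)\le d$, and no $\vec{C}_3$, $\vec{C}_4^{ - }$, $C_4^{\Uparrow}$, or $C_6^{\Uparrow}$ as a subgraph, then $D$ has a quasi-kernel of order at most $\frac{(d^2+4)n}{(d+2)^2}$. Moreover, such a quasi-kernel can be found in $O(n^2)$ time.
   Context: Digraphs are finite, without loops and without repeated edges $(u,v)$; both $(u,v)$ and $(v,u)$ may be present. A source is a vertex with in-degree zero; a digraph is sourceless if it has no source. $\dist(v,u)$ is the length of a shortest directed path from $v$ to $u$ ($\infty$ if none exists). A quasi-kernel of $D$ is an independent set $Q$ (no edges in either direction between vertices of $Q$) such that for every vertex $u$ of $D$ there is $v\in Q$ with $\dist(v,u)\le 2$. The forbidden digraphs (as not necessarily induced subgraphs, with distinct vertices) are: $\vec{C}_3$: the directed triangle $a\to b\to c\to a$; $\vec{C}_4^{ - }$: the directed 4-cycle with one edge reversed, i.e. edges $a\to b\to c\to e$ and $a\to e$; $C_4^{\Uparrow}$: the 4-cycle formed by two internally disjoint directed paths of length 2 with the same start and end, $a\to b\to e$ and $a\to c\to e$; $C_6^{\Uparrow}$: the 6-cycle formed by two internally disjoint directed paths of length 3 with the same start and end, $a\to b_1\to b_2\to e$ and $a\to c_1\to c_2\to e$. For the running time, $D$ is stored as a dictionary keyed by vertices giving each vertex's in-neighbourhood and out-neighbourhood as sets, with constant time lookup; $d$ is fixed, so the constant in $O(n^2)$ may depend on $d$. -}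

module Defs where

open import Data.Bool.Base using (Bool; true; false; not; _∧_)
open import Data.Fin.Base using (Fin; zero; suc; toℕ; fromℕ; fromℕ<; inject₁)
open import Data.Fin.Patterns
open import Data.Fin.Properties using (all?)
open import Data.Fin.Subset using (Subset; _∈_; _∉_; _∪_; ⁅_⁆; ⊥; ∣_∣)
open import Data.Fin.Subset.Properties using (_∈?_)
open import Data.List.Base using (List; []; _∷_; map; filter; foldr; allFin)
open import Data.Nat.Base
open import Data.Nat.Properties using (_<?_)
open import Data.Product.Base using (∃-syntax; _×_)
open import Data.Vec.Base using (lookup; tabulate)
open import Function.Definitions using (Injective)
open import Relation.Binary.PropositionalEquality using (_≡_)
open import Relation.Nullary using (¬_; does; yes; no; ¬?)
open import Relation.Nullary.Decidable using (toWitness)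

private
  variable
    m n : ℕ

record Digraph (n : ℕ) : Set where
  field
    N⁺       : Fin n → Subset n
    loopless : ∀ v → v ∉ N⁺ v

open Digraph public

N⁻ : Digraph n → Fin n → Subset n
N⁻ D v = tabulate λ u → lookup (N⁺ D u) v

infix 4 _⟨_⟶_⟩

_⟨_⟶_⟩ : Digraph n → Fin n → Fin n → Set
D ⟨ u ⟶ v ⟩ = v ∈ N⁺ D u

outdegree : Digraph n → Fin n → ℕ
outdegree D v = ∣ N⁺ D v ∣

indegree : Digraph n → Fin n → ℕ
indegree D v = ∣ N⁻ D v ∣

Δ⁺ : Digraph n → ℕ
Δ⁺ {n} D = foldr _⊔_ 0 (map (outdegree D) (allFin n))

Source : Digraph n → Fin n → Set
Source D v = indegree D v ≡ 0

Sourceless : Digraph n → Set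
Sourceless D = ∀ v → ¬ Source D v

-- Subgraphs need not be induced.
record ContainsSubgraph (D : Digraph n) (H : Digraph m) : Set where
  field
    embed     : Fin m → Fin n
    injective : Injective _≡_ _≡_ embed
    preserves : ∀ x y → H ⟨ x ⟶ y ⟩ → D ⟨ embed x ⟶ embed y ⟩

_FreeOf_ : Digraph n → Digraph m → Set
D FreeOf H = ¬ ContainsSubgraph D H

-- a , b , c = 0 , 1 , 2
C⃗₃ : Digraph 3
C⃗₃ = record { N⁺ = N ; loopless = toWitness {a? = all? λ v → ¬? (v ∈? N v)} _ }
  where
  N : Fin 3 → Subset 3
  N 0F = ⁅ 1F ⁆
  N 1F = ⁅ 2F ⁆
  N 2F = ⁅ 0F ⁆

-- a , b , c , e = 0 , 1 , 2 , 3
C⃗₄⁻ : Digraph 4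
C⃗₄⁻ = record { N⁺ = N ; loopless = toWitness {a? = all? λ v → ¬? (v ∈? N v)} _ }
  where
  N : Fin 4 → Subset 4
  N 0F = ⁅ 1F ⁆ ∪ ⁅ 3F ⁆
  N 1F = ⁅ 2F ⁆
  N 2F = ⁅ 3F ⁆
  N 3F = ⊥

-- a , b , c , e = 0 , 1 , 2 , 3
C₄⇑ : Digraph 4
C₄⇑ = record { N⁺ = N ; loopless = toWitness {a? = all? λ v → ¬? (v ∈? N v)} _ }
  where
  N : Fin 4 → Subset 4
  N 0F = ⁅ 1F ⁆ ∪ ⁅ 2F ⁆
  N 1F = ⁅ 3F ⁆
  N 2F = ⁅ 3F ⁆
  N 3F = ⊥

-- a , b₁ , b₂ , c₁ , c₂ , e = 0 , 1 , 2 , 3 , 4 , 5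
C₆⇑ : Digraph 6
C₆⇑ = record { N⁺ = N ; loopless = toWitness {a? = all? λ v → ¬? (v ∈? N v)} _ }
  where
  N : Fin 6 → Subset 6
  N 0F = ⁅ 1F ⁆ ∪ ⁅ 3F ⁆
  N 1F = ⁅ 2F ⁆
  N 2F = ⁅ 5F ⁆
  N 3F = ⁅ 4F ⁆
  N 4F = ⁅ 5F ⁆
  N 5F = ⊥

record InClass (d : ℕ) (D : Digraph n) : Set where
  field
    sourceless : Sourceless D
    Δ⁺≤d       : Δ⁺ D ≤ d
    noC⃗₃       : D FreeOf C⃗₃
    noC⃗₄⁻      : D FreeOf C⃗₄⁻
    noC₄⇑      : D FreeOf C₄⇑
    noC₆⇑      : D FreeOf C₆⇑

record Path (D : Digraph n) (v u : Fin n) (k : ℕ) : Set where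
  field
    vertex   : Fin (suc k) → Fin n
    distinct : Injective _≡_ _≡_ vertex
    start    : vertex zero ≡ v
    end      : vertex (fromℕ k) ≡ u
    edge     : ∀ (i : Fin k) → D ⟨ vertex (inject₁ i) ⟶ vertex (suc i) ⟩

-- dist(v,u) = k.  Infinite distance is the absence of any such k.
IsDist : Digraph n → Fin n → Fin n → ℕ → Set
IsDist D v u k = Path D v u k × (∀ j → Path D v u j → k ≤ j)

Independent : Digraph n → Subset n → Set
Independent D Q = ∀ u v → u ∈ Q → v ∈ Q → ¬ D ⟨ u ⟶ v ⟩

record QuasiKernel (D : Digraph n) (Q : Subset n) : Set where
  field
    independent : Independent D Q
    reaches     : ∀ u → ∃[ v ] v ∈ Q × ∃[ k ] IsDist D v u k × k ≤ 2

-- |Q| ≤ (d² + 4) n / (d + 2)², with the positive denominator cleared.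
record SmallQuasiKernel (d : ℕ) (D : Digraph n) (Q : Subset n) : Set where
  field
    quasiKernel : QuasiKernel D Q
    small       : ∣ Q ∣ * (d + 2) ^ 2 ≤ (d ^ 2 + 4) * n

-- A random access machine with named registers and named unbounded arrays of
-- natural numbers, all initially zero, and read-only access to the input
-- digraph, whose vertices are the keys 0 , … , n - 1.  Every constructor
-- evaluated costs one unit.  The only growing arithmetic operation is the
-- successor, so a number computed in time t is at most t + n + (a constant of
-- the program): unit cost is charged only for operations on short words.

data Direction : Set where
  outward inward : Direction

nbhd : Digraph n → Direction → Fin n → Subset n
nbhd D outward = N⁺ D
nbhd D inward  = N⁻ D

-- The input dictionary answers in unit time: the size of a neighbourhood, its
-- i-th element, and membership in it.  Sets are enumerated increasingly; the
-- choice of order is immaterial for quadratic time, as membership queries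
-- alone recover this enumeration for all vertices in O(n²).
data Expr : Set where
  lit   : ℕ → Expr
  var   : ℕ → Expr
  read  : (a : ℕ) (i : Expr) → Expr
  succ  : Expr → Expr
  _⊖_   : Expr → Expr → Expr
  order : Expr
  deg   : Direction → (v : Expr) → Expr
  nbr   : Direction → (v i : Expr) → Expr

data Test : Set where
  _lt_ _eq_ : Expr → Expr → Test
  member    : Direction → (u v : Expr) → Test   -- u ∈ N⁺(v) or u ∈ N⁻(v)
  neg       : Test → Test
  _and_     : Test → Test → Test

data Cmd : Set where
  skip          : Cmd
  _≔_           : (x : ℕ) → Expr → Cmd
  write         : (a : ℕ) (i e : Expr) → Cmd
  _⨾_           : Cmd → Cmd → Cmd
  if_then_else_ : Test → Cmd → Cmd → Cmd
  while_loop_   : Test → Cmd → Cmd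

infixr 5 _⨾_
infix  6 _≔_ if_then_else_ while_loop_
infixl 7 _⊖_

record State : Set where
  constructor state
  field
    reg : ℕ → ℕ
    arr : ℕ → ℕ → ℕ

open State public

initial : State
initial = state (λ _ → 0) (λ _ _ → 0)

update : {A : Set} → (ℕ → A) → ℕ → A → (ℕ → A)
update f x a y with x ≡ᵇ y
... | true  = a
... | false = f y

atVertex : {A : Set} → A → (Fin n → A) → ℕ → A
atVertex {n} default f k with k <? n
... | yes k<n = f (fromℕ< k<n)
... | no  _   = default

elements : Subset n → List (Fin n)
elements {n} p = filter (_∈? p) (allFin n)

nth : List ℕ → ℕ → ℕ
nth []       _       = 0
nth (x ∷ xs) zero    = x
nth (x ∷ xs) (suc i) = nth xs i

⟦_⟧ : Expr → Digraph n → State → ℕ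
⟦ lit k ⟧ D s     = k
⟦ var x ⟧ D s     = reg s x
⟦ read a i ⟧ D s  = arr s a (⟦ i ⟧ D s)
⟦ succ e ⟧ D s    = suc (⟦ e ⟧ D s)
⟦ e ⊖ f ⟧ D s     = ⟦ e ⟧ D s ∸ ⟦ f ⟧ D s
⟦_⟧ {n} order D s = n
⟦ deg δ v ⟧ D s   = atVertex 0 (λ x → ∣ nbhd D δ x ∣) (⟦ v ⟧ D s)
⟦ nbr δ v i ⟧ D s =
  atVertex 0 (λ x → nth (map toℕ (elements (nbhd D δ x))) (⟦ i ⟧ D s)) (⟦ v ⟧ D s)

test : Test → Digraph n → State → Bool
test (e lt f) D s       = ⟦ e ⟧ D s <ᵇ ⟦ f ⟧ D s
test (e eq f) D s       = ⟦ e ⟧ D s ≡ᵇ ⟦ f ⟧ D s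
test (member δ u v) D s =
  atVertex false
    (λ x → atVertex false (λ y → does (y ∈? nbhd D δ x)) (⟦ u ⟧ D s))
    (⟦ v ⟧ D s)
test (neg b) D s        = not (test b D s)
test (b and c) D s      = test b D s ∧ test c D s

costE : Expr → ℕ
costE (lit _)     = 1
costE (var _)     = 1
costE (read _ i)  = 1 + costE i
costE (succ e)    = 1 + costE e
costE (e ⊖ f)     = 1 + costE e + costE f
costE order       = 1
costE (deg _ v)   = 1 + costE v
costE (nbr _ v i) = 1 + costE v + costE i

costT : Test → ℕ
costT (e lt f)       = 1 + costE e + costE f
costT (e eq f)       = 1 + costE e + costE f
costT (member _ u v) = 1 + costE u + costE v
costT (neg b)        = 1 + costT b
costT (b and c)      = 1 + costT b + costT c

-- D ⊢ c , s ⇓ s′ ▷ t : on input D, command c started in state s halts in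
-- state s′ after exactly t units of time.
infix 3 _⊢_,_⇓_▷_

data _⊢_,_⇓_▷_ (D : Digraph n) : Cmd → State → State → ℕ → Set where

  skip : ∀ {s} → D ⊢ skip , s ⇓ s ▷ 1

  assign : ∀ {s x e} →
    D ⊢ x ≔ e , s ⇓ state (update (reg s) x (⟦ e ⟧ D s)) (arr s) ▷ 1 + costE e

  write : ∀ {s a i e} →
    D ⊢ write a i e , s
      ⇓ state (reg s) (update (arr s) a (update (arr s a) (⟦ i ⟧ D s) (⟦ e ⟧ D s)))
      ▷ 1 + costE i + costE e

  seq : ∀ {c₁ c₂ s s′ s″ t₁ t₂} →
    D ⊢ c₁ , s ⇓ s′ ▷ t₁ →
    D ⊢ c₂ , s′ ⇓ s″ ▷ t₂ →
    D ⊢ c₁ ⨾ c₂ , s ⇓ s″ ▷ t₁ + t₂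

  if-true : ∀ {b c₁ c₂ s s′ t} →
    test b D s ≡ true →
    D ⊢ c₁ , s ⇓ s′ ▷ t →
    D ⊢ if b then c₁ else c₂ , s ⇓ s′ ▷ 1 + costT b + t

  if-false : ∀ {b c₁ c₂ s s′ t} →
    test b D s ≡ false →
    D ⊢ c₂ , s ⇓ s′ ▷ t →
    D ⊢ if b then c₁ else c₂ , s ⇓ s′ ▷ 1 + costT b + t

  while-true : ∀ {b c s s′ s″ t₁ t₂} →
    test b D s ≡ true →
    D ⊢ c , s ⇓ s′ ▷ t₁ →
    D ⊢ while b loop c , s′ ⇓ s″ ▷ t₂ →
    D ⊢ while b loop c , s ⇓ s″ ▷ 1 + costT b + t₁ + t₂

  while-false : ∀ {b c s} →
    test b D s ≡ false →
    D ⊢ while b loop c , s ⇓ s ▷ 1 + costT b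

output : State → Subset n
output s = tabulate λ v → arr s 0 (toℕ v) ≡ᵇ 1

_∈O_ : (ℕ → ℕ) → (ℕ → ℕ) → Set
f ∈O g = ∃[ c ] ∃[ N ] ∀ n → N ≤ n → f n ≤ c * g n

FindsSmallQuasiKernels : (d : ℕ) → Cmd → (T : ℕ → ℕ) → Set
FindsSmallQuasiKernels d P T =
  ∀ (n : ℕ) (D : Digraph n) → InClass d D →
  ∃[ s ] ∃[ t ] (D ⊢ P , initial ⇓ s ▷ t) × t ≤ T n × SmallQuasiKernel d D (output s)

{-# OPTIONS --safe #-}

-- Let f choose an in-neighbour of every vertex.  Repeatedly make a vertex v without uncoloured
-- f-child a leaf of the root f v; the vertices left over are permuted by f, and each of their
-- cycles is coloured alternately, so that only on an odd cycle one root x keeps no leaf.  Let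
-- l u ≤ d be the number of leaves of u.  Select vertices greedily, in decreasing order of l as
-- long as l ≥ 1, each undominated by those selected before; call the result T, and continue to a
-- selection S that covers every vertex.  An odd cycle is broken at a dominated x, or else at
-- x = f v for an undominated v, which is then selected.  Edges inside S point to earlier vertices,
-- so scanning S backwards yields an independent Q ⊆ S absorbing S, that is, a quasi-kernel.
--
-- Every root u outside T has an in-neighbour t in T with l u ≤ l t, or has l u = 0 and u = f a
-- with a in T; in the latter case u or a lies outside Q.  The leaves of t ∈ T and the roots
-- dominated by T lie outside Q.  If g roots, t included, are charged to t ∈ T, then g + l t ≤ d + 1
-- and they account for at most g (1 + l t) vertices, at least g - 1 + l t of which can be credited
-- as missing from Q; the bound follows from 4 d g (1 + l) ≤ (d + 2)² (g - 1 + l).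

module Submission where

open import Defs
open import Data.Bool.Base using (Bool; true; false; _∨_; T)
open import Data.Bool.Properties using (T-≡)
open import Data.Empty using (⊥; ⊥-elim)
open import Data.Fin.Base as F using (Fin; toℕ; fromℕ<; zero; suc)
open import Data.Fin.Patterns
open import Data.Fin.Properties as F using (toℕ<n; toℕ-fromℕ<; toℕ-injective; any?; injective⇒≤)
open import Data.Fin.Subset using (Subset; Nonempty; _∈_; _∉_; ∣_∣; inside; outside)
open import Data.Fin.Subset.Properties using (_∈?_; drop-there; nonempty?; Empty-unique; ∣⊥∣≡0)
open import Data.List.Base using ([]; _∷_; map; foldr; allFin)
open import Data.List.Membership.Propositional using () renaming (_∈_ to _∈ˡ_)
open import Data.List.Membership.Propositional.Properties using (∈-filter⁺; ∈-filter⁻; ∈-allFin)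
open import Data.List.Relation.Unary.Any as Any using ()
open import Data.Nat.Base
open import Data.Nat.Properties
open import Data.Nat.Solver using (module +-*-Solver)
open import Data.Product.Base using (∃-syntax; _×_; _,_; proj₁; proj₂)
open import Data.Sum.Base using (_⊎_; inj₁; inj₂; [_,_]′)
open import Data.Unit.Base using (tt)
open import Data.Vec.Base using ([]; _∷_; there; lookup)
open import Data.Vec.Properties using ([]=⇒lookup; lookup⇒[]=; lookup∘tabulate)
open import Function.Base using (_∘_)
open import Function.Bundles using (Equivalence)
open import Function.Definitions using (Injective)
open import Relation.Binary.PropositionalEquality
open import Relation.Nullary
open import Relation.Nullary.Decidable using (_×-dec_; ¬?; dec-true; decidable-stable)
open import Algebra.Properties.CommutativeMonoid.Sum +-0-commutativeMonoid using (sum; sum-cong-≗; ∑-distrib-+; ∑-comm; sum-replicate-zero)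

-- Loop programs and their running time

-- The difficulty is circular. Where an odd cycle may be broken depends on what the selection
-- dominates, while the selection follows leaf counts that depend on the breaking. The circle opens
-- because a cycle vertex ends with at most one leaf: counts of two or more are already final after
-- stripping. So the selection runs for l ≥ 2, the cycles are broken next, and only then come l = 1
-- and l = 0. Selecting v when a cycle is broken at f v merely anticipates the pass for l = 1: if f
-- v stays leafless, then v is itself a root with one leaf. The constant: by AM-GM, 4 g (1 + l) ≤ (s
-- + 2)² for s = g + l - 1 ≤ d, and (s + 2)² / s increases from s = 2 on, so s = d is the worst
-- case; s = 1 means g = l = 1, where 8 d ≤ (d + 2)² is checked directly. The fraction 4 d / (d +
-- 2)² missing from Q leaves (d² + 4) / (d + 2)². Every pass is a loop of depth two, and only the
-- number of passes depends on d.

data Prog : ℕ → Set where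
  put  : ∀ {k} (a : ℕ) (i e : Expr) → Prog k
  _▹_  : ∀ {k} → Prog k → Prog k → Prog k
  when : ∀ {k} → Test → Prog k → Prog k
  for  : ∀ {k} → Prog k → Prog (suc k)

infixr 5 _▹_

-- A loop of nesting depth suc k counts in register k.
compile : ∀ {k} → Prog k → Cmd
compile (put a i e)     = write a i e
compile (p ▹ q)         = compile p ⨾ compile q
compile (when b p)      = if b then compile p else skip
compile (for {k} p)     =
  k ≔ lit 0 ⨾ while var k lt order loop (compile p ⨾ k ≔ succ (var k))

-- The coefficient of `suc n ^ k` in the time bound. In a loop, 7 is the price of the counter per
-- round: 4 for the successful test and 3 for the increment. The initialisation (2) and the failing
-- last test (4) are paid by the extra round that `suc n` grants.
coef : ∀ {k} → Prog k → ℕ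
coef (put a i e) = 1 + costE i + costE e
coef (p ▹ q)     = coef p + coef q
coef (when b p)  = 2 + costT b + coef p
coef (for p)     = coef p + 7

setReg : ℕ → ℕ → State → State
setReg k x s = state (update (reg s) k x) (arr s)

setArr : ℕ → ℕ → ℕ → State → State
setArr a i x s = state (reg s) (update (arr s) a (update (arr s a) i x))

module _ {n : ℕ} (D : Digraph n) where

  mutual
    run : ∀ {k} → Prog k → State → State
    run (put a i e) s = setArr a (⟦ i ⟧ D s) (⟦ e ⟧ D s) s
    run (p ▹ q) s     = run q (run p s)
    run (when b p) s with test b D s
    ... | true  = run p s
    ... | false = s
    run (for {k} p) s = iterate p n (setReg k 0 s)

    iterate : ∀ {k} → Prog k → ℕ → State → State
    iterate p zero    s = s
    iterate {k} p (suc m) s = iterate p m (next k (run p s))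

    next : ℕ → State → State
    next k s = setReg k (suc (reg s k)) s

update-same : ∀ {A : Set} (f : ℕ → A) x a → update f x a x ≡ a
update-same f x a with x ≡ᵇ x in same
... | true  = refl
... | false = ⊥-elim (subst T same (≡⇒≡ᵇ x x refl))

update-other : ∀ {A : Set} (f : ℕ → A) {x y} a → x ≢ y → update f x a y ≡ f y
update-other f {x} {y} a x≢y with x ≡ᵇ y in same
... | true  = ⊥-elim (x≢y (≡ᵇ⇒≡ x y (subst T (sym same) tt)))
... | false = refl

module _ {n : ℕ} (D : Digraph n) where

  mutual
    -- The depth index exists for this: a body of depth `k` writes only registers below `k`, so the
    -- counter of the enclosing loop, register `k`, survives it.
    run-reg : ∀ {k} (p : Prog k) s {j} → k ≤ j → reg (run D p s) j ≡ reg s j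
    run-reg (put a i e) s k≤j = refl
    run-reg (p ▹ q) s k≤j = trans (run-reg q (run D p s) k≤j) (run-reg p s k≤j)
    run-reg (when b p) s k≤j with test b D s
    ... | true  = run-reg p s k≤j
    ... | false = refl
    run-reg (for {k} p) s k<j =
      trans (iterate-reg p n (setReg k 0 s) k<j) (update-other (reg s) 0 (<⇒≢ k<j))

    iterate-reg : ∀ {k} (p : Prog k) m s {j} → k < j → reg (iterate D p m s) j ≡ reg s j
    iterate-reg p zero s k<j = refl
    iterate-reg {k} p (suc m) s k<j =
      trans (iterate-reg p m (next D k (run D p s)) k<j)
        (trans (update-other (reg (run D p s)) _ (<⇒≢ k<j)) (run-reg p s (<⇒≤ k<j)))

  next-counter : ∀ {k} (p : Prog k) s → reg (next D k (run D p s)) k ≡ suc (reg s k)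
  next-counter {k} p s =
    trans (update-same (reg (run D p s)) k _) (cong suc (run-reg p s ≤-refl))

  private
    budget : ℕ → ℕ
    budget k = suc n ^ k

    1≤budget : ∀ k → 1 ≤ budget k
    1≤budget k = m^n>0 (suc n) k

    afford : ∀ {t} c k → t ≤ c → t ≤ c * budget k
    afford c k t≤c = ≤-trans t≤c (≤-trans (≤-reflexive (sym (*-identityʳ c))) (*-monoʳ-≤ c (1≤budget k)))

  loop-bound : ∀ c k → 2 + (n * (c * budget k + 7) + 4) ≤ (c + 7) * budget (suc k)
  loop-bound c k = begin
    2 + (n * (c * B + 7) + 4)        ≡⟨ regroup n (c * B) ⟩
    n * (c * B) + (n * 7 + 6)        ≤⟨ +-mono-≤ (m≤n+m (n * (c * B)) (c * B)) (≤-trans (+-monoʳ-≤ (n * 7) (n≤1+n 6)) (m≤m*n _ B {{>-nonZero (1≤budget k)}})) ⟩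
    suc n * (c * B) + (n * 7 + 7) * B ≡⟨ collect n c B ⟩
    (c + 7) * (suc n * B)            ∎
    where
    open ≤-Reasoning
    B = budget k
    open +-*-Solver
    regroup : ∀ n x → 2 + (n * (x + 7) + 4) ≡ n * x + (n * 7 + 6)
    regroup = solve 2 (λ n x → con 2 :+ (n :* (x :+ con 7) :+ con 4) := n :* x :+ (n :* con 7 :+ con 6)) refl
    collect : ∀ n c B → suc n * (c * B) + (n * 7 + 7) * B ≡ (c + 7) * (suc n * B)
    collect = solve 3 (λ n c B → (con 1 :+ n) :* (c :* B) :+ (n :* con 7 :+ con 7) :* B := (c :+ con 7) :* ((con 1 :+ n) :* B)) refl

  mutual
    compile-runs : ∀ {k} (p : Prog k) s →
      ∃[ t ] (D ⊢ compile p , s ⇓ run D p s ▷ t) × t ≤ coef p * suc n ^ k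
    compile-runs {k} p@(put a i e) s = _ , write , afford (coef p) k ≤-refl
    compile-runs {k} (p ▹ q) s
      with t₁ , d₁ , b₁ ← compile-runs p s | t₂ , d₂ , b₂ ← compile-runs q (run D p s)
      = _ , seq d₁ d₂
      , ≤-trans (+-mono-≤ b₁ b₂) (≤-reflexive (sym (*-distribʳ-+ (budget k) (coef p) (coef q))))
    compile-runs {k} (when b p) s with test b D s in same
    ... | true with t , d , bound ← compile-runs p s
      = _ , if-true same d
      , ≤-trans (+-mono-≤ (afford (2 + costT b) k (s≤s (n≤1+n _))) bound)
          (≤-reflexive (sym (*-distribʳ-+ (budget k) (2 + costT b) (coef p))))
    ... | false
      = _ , if-false same skip
      , afford (coef (when b p)) k
          (≤-trans (≤-reflexive (+-comm (1 + costT b) 1)) (m≤m+n (2 + costT b) (coef p)))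
    compile-runs (for {k} p) s
      with t , d , bound ← loop-runs p n (setReg k 0 s) (cong (_+ n) (update-same (reg s) k 0))
      = _ , seq assign d , ≤-trans (+-monoʳ-≤ 2 bound) (loop-bound (coef p) k)

    loop-runs : ∀ {k} (p : Prog k) m s → reg s k + m ≡ n →
      ∃[ t ] (D ⊢ while var k lt order loop (compile p ⨾ k ≔ succ (var k)) , s ⇓ iterate D p m s ▷ t)
        × t ≤ m * (coef p * suc n ^ k + 7) + 4
    loop-runs {k} p zero s last = _ , while-false stop , ≤-refl
      where
      stop : (reg s k <ᵇ n) ≡ false
      stop with reg s k <ᵇ n in less
      ... | false = refl
      ... | true  = ⊥-elim (<-irrefl (trans (sym (+-identityʳ _)) last) (<ᵇ⇒< _ _ (subst T (sym less) tt)))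
    loop-runs {k} p (suc m) s more
      with t₁ , d₁ , b₁ ← compile-runs p s
      with t₂ , d₂ , b₂ ← loop-runs p m (next D k (run D p s))
             (trans (cong (_+ m) (next-counter p s)) (trans (sym (+-suc _ m)) more))
      = _ , while-true go (seq d₁ assign) d₂ , bound
      where
      go : (reg s k <ᵇ n) ≡ true
      go with reg s k <ᵇ n in less
      ... | true  = refl
      ... | false = ⊥-elim (subst T less (<⇒<ᵇ (≤-trans (m≤m+n _ m) (≤-reflexive (trans (sym (+-suc _ m)) more)))))
      C = coef p * budget k
      bound : 4 + (t₁ + 3) + t₂ ≤ suc m * (C + 7) + 4
      bound = begin
        4 + (t₁ + 3) + t₂               ≡⟨ regroup t₁ t₂ ⟩
        t₁ + 7 + t₂                     ≤⟨ +-mono-≤ (+-monoˡ-≤ 7 b₁) b₂ ⟩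
        C + 7 + (m * (C + 7) + 4)       ≡⟨ sym (+-assoc (C + 7) (m * (C + 7)) 4) ⟩
        suc m * (C + 7) + 4             ∎
        where
        open ≤-Reasoning
        open +-*-Solver
        regroup : ∀ x y → 4 + (x + 3) + y ≡ x + 7 + y
        regroup = solve 2 (λ x y → con 4 :+ (x :+ con 3) :+ y := x :+ con 7 :+ y) refl

  -- Registers hold nothing but counters, so an invariant speaks of the arrays alone. The counter
  -- enters as a vertex, since every loop runs through all vertices.
  for-rule : ∀ {k} (p : Prog k) (I : ℕ → (ℕ → ℕ → ℕ) → Set) →
    (∀ v s → reg s k ≡ toℕ v → I (toℕ v) (arr s) → I (suc (toℕ v)) (arr (run D p s))) →
    ∀ s → I 0 (arr s) → I n (arr (run D (for p) s))
  for-rule {k} p I step s I0 = go n (setReg k 0 s) 0 refl (update-same (reg s) k 0) I0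
    where
    go : ∀ m s i → i + m ≡ n → reg s k ≡ i → I i (arr s) → I n (arr (iterate D p m s))
    go zero s i i+0≡n _ Ii = subst (λ j → I j (arr s)) (trans (sym (+-identityʳ i)) i+0≡n) Ii
    go (suc m) s i i+m≡n regi Ii =
      go m (next D k (run D p s)) (suc i) (trans (sym (+-suc i m)) i+m≡n)
        (trans (next-counter p s) (cong suc regi))
        (subst (λ j → I (suc j) (arr (run D p s))) (toℕ-fromℕ< i<n)
          (step (fromℕ< i<n) s (trans regi (sym (toℕ-fromℕ< i<n)))
            (subst (λ j → I j (arr s)) (sym (toℕ-fromℕ< i<n)) Ii)))
      where
      i<n : i < n
      i<n = ≤-trans (m≤m+n (suc i) m) (≤-reflexive (trans (sym (+-suc i m)) i+m≡n))

-- Frame rule and Hoare rules for tests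

touches : ∀ {k} → ℕ → Prog k → Bool
touches b (put a i e) = a ≡ᵇ b
touches b (p ▹ q)     = touches b p ∨ touches b q
touches b (when c p)  = touches b p
touches b (for p)     = touches b p

module _ {n : ℕ} (D : Digraph n) where

  mutual
    -- `touches` is Boolean-valued so that for each concrete program the premise is just `refl`.
    frame : ∀ {k} b (p : Prog k) s → touches b p ≡ false → arr (run D p s) b ≡ arr s b
    frame b (put a i e) s free with a ≡ᵇ b
    frame b (put a i e) s ()   | true
    frame b (put a i e) s free | false = refl
    frame b (p ▹ q) s free with touches b p in untouched
    frame b (p ▹ q) s ()   | true
    frame b (p ▹ q) s free | false = trans (frame b q (run D p s) free) (frame b p s untouched)
    frame b (when c p) s free with test c D s
    ... | true  = frame b p s free
    ... | false = refl
    frame b (for {k} p) s free = iterate-frame b p n (setReg k 0 s) free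

    iterate-frame : ∀ {k} b (p : Prog k) m s → touches b p ≡ false →
      arr (iterate D p m s) b ≡ arr s b
    iterate-frame b p zero s free = refl
    iterate-frame {k} b p (suc m) s free =
      trans (iterate-frame b p m (next D k (run D p s)) free) (frame b p s free)

  atVertex-toℕ : ∀ {A : Set} (a : A) (g : Fin n → A) v → atVertex a g (toℕ v) ≡ g v
  atVertex-toℕ a g v with toℕ v <? n
  ... | yes v<n = cong g (F.fromℕ<-toℕ v v<n)
  ... | no  v≮n = ⊥-elim (v≮n (F.toℕ<n v))

  Holds : Test → State → Set
  Holds (e lt f) s       = ⟦ e ⟧ D s < ⟦ f ⟧ D s
  Holds (e eq f) s       = ⟦ e ⟧ D s ≡ ⟦ f ⟧ D s
  Holds (member δ u v) s =
    ∃[ i ] ∃[ j ] ⟦ u ⟧ D s ≡ toℕ i × ⟦ v ⟧ D s ≡ toℕ j × i ∈ nbhd D δ j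
  Holds (neg b) s        = ¬ Holds b s
  Holds (b and c) s      = Holds b s × Holds c s

  mutual
    test⇒Holds : ∀ b s → test b D s ≡ true → Holds b s
    test⇒Holds (e lt f) s yes! = <ᵇ⇒< _ _ (subst T (sym yes!) tt)
    test⇒Holds (e eq f) s yes! = ≡ᵇ⇒≡ _ _ (subst T (sym yes!) tt)
    test⇒Holds (member δ u v) s yes! with ⟦ v ⟧ D s <? n
    ... | yes v<n with ⟦ u ⟧ D s <? n
    ...   | yes u<n with fromℕ< u<n ∈? nbhd D δ (fromℕ< v<n)
    ...     | yes u∈ = _ , _ , sym (F.toℕ-fromℕ< u<n) , sym (F.toℕ-fromℕ< v<n) , u∈
    test⇒Holds (neg b) s yes! holds rewrite Holds⇒test b s holds = contradiction yes! λ ()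
    test⇒Holds (b and c) s yes! with test b D s in b! | test c D s in c!
    ... | true | true = test⇒Holds b s b! , test⇒Holds c s c!

    Holds⇒test : ∀ b s → Holds b s → test b D s ≡ true
    Holds⇒test (e lt f) s holds = T-≡ .Equivalence.to (<⇒<ᵇ holds)
    Holds⇒test (e eq f) s holds = T-≡ .Equivalence.to (≡⇒≡ᵇ _ _ holds)
    Holds⇒test (member δ u v) s (i , j , u≡i , v≡j , i∈)
      rewrite u≡i | v≡j
            | atVertex-toℕ false (λ x → atVertex false (λ y → does (y ∈? nbhd D δ x)) (toℕ i)) j
            | atVertex-toℕ false (λ y → does (y ∈? nbhd D δ j)) i
      = dec-true (i ∈? nbhd D δ j) i∈
    Holds⇒test (neg b) s ¬holds with test b D s in b!
    ... | true  = ⊥-elim (¬holds (test⇒Holds b s b!))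
    ... | false = refl
    Holds⇒test (b and c) s (hb , hc) rewrite Holds⇒test b s hb = Holds⇒test c s hc

  when-rule : ∀ {k} b (p : Prog k) s (P : (ℕ → ℕ → ℕ) → Set) →
    (Holds b s → P (arr (run D p s))) → (¬ Holds b s → P (arr s)) →
    P (arr (run D (when b p) s))
  when-rule b p s P yes! no! with test b D s in answer
  ... | true  = yes! (test⇒Holds b s answer)
  ... | false = no! λ holds → contradiction (trans (sym answer) (Holds⇒test b s holds)) λ ()

-- Sums of indicators

𝟙 : {A : Set} → Dec A → ℕ
𝟙 (yes _) = 1
𝟙 (no  _) = 0

𝟙≤1 : {A : Set} (a? : Dec A) → 𝟙 a? ≤ 1
𝟙≤1 (yes _) = ≤-refl
𝟙≤1 (no  _) = z≤n

𝟙-yes : {A : Set} (a? : Dec A) → A → 𝟙 a? ≡ 1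
𝟙-yes (yes _) _ = refl
𝟙-yes (no ¬a) a = ⊥-elim (¬a a)

𝟙-no : {A : Set} (a? : Dec A) → ¬ A → 𝟙 a? ≡ 0
𝟙-no (yes a) ¬a = ⊥-elim (¬a a)
𝟙-no (no _)  _  = refl

𝟙-mono : {A B : Set} (a? : Dec A) (b? : Dec B) → (A → B) → 𝟙 a? ≤ 𝟙 b?
𝟙-mono (no _)  b?      _ = z≤n
𝟙-mono (yes a) (yes _) _ = ≤-refl
𝟙-mono (yes a) (no ¬b) h = ⊥-elim (¬b (h a))

𝟙-cong : {A B : Set} (a? : Dec A) (b? : Dec B) → (A → B) → (B → A) → 𝟙 a? ≡ 𝟙 b?
𝟙-cong a? b? to from = ≤-antisym (𝟙-mono a? b? to) (𝟙-mono b? a? from)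

sum-mono : ∀ {n} (g h : Fin n → ℕ) → (∀ v → g v ≤ h v) → sum g ≤ sum h
sum-mono {zero}  g h g≤h = z≤n
sum-mono {suc n} g h g≤h = +-mono-≤ (g≤h zero) (sum-mono (g ∘ suc) (h ∘ suc) (g≤h ∘ suc))

sum-strict : ∀ {n} (g h : Fin n → ℕ) → (∀ v → g v ≤ h v) → ∀ z → g z < h z → sum g < sum h
sum-strict g h g≤h zero    z< = +-mono-<-≤ z< (sum-mono (g ∘ suc) (h ∘ suc) (g≤h ∘ suc))
sum-strict g h g≤h (suc z) z< =
  +-mono-≤-< (g≤h zero) (sum-strict (g ∘ suc) (h ∘ suc) (g≤h ∘ suc) z z<)

sum-zero : ∀ {n} (g : Fin n → ℕ) → (∀ v → g v ≡ 0) → sum g ≡ 0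
sum-zero {n} g g≡0 = trans (sum-cong-≗ g≡0) (sum-replicate-zero n)

term≤sum : ∀ {n} (g : Fin n → ℕ) z → g z ≤ sum g
term≤sum g zero    = m≤m+n _ _
term≤sum g (suc z) = ≤-trans (term≤sum (g ∘ suc) z) (m≤n+m _ (g zero))

sum-single : ∀ {n} (g : Fin n → ℕ) z → (∀ v → v ≢ z → g v ≡ 0) → sum g ≡ g z
sum-single g zero    off = trans (cong (g zero +_) (sum-zero (g ∘ suc) λ v → off (suc v) λ ())) (+-identityʳ _)
sum-single g (suc z) off =
  cong₂ _+_ (off zero λ ()) (sum-single (g ∘ suc) z λ v v≢z → off (suc v) (v≢z ∘ F.suc-injective))

sum-one : ∀ n → sum {n} (λ _ → 1) ≡ n
sum-one zero    = refl
sum-one (suc n) = cong suc (sum-one n)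

sum-scale : ∀ {n} c (g : Fin n → ℕ) → sum (λ v → c * g v) ≡ c * sum g
sum-scale {zero}  c g = sym (*-zeroʳ c)
sum-scale {suc n} c g = trans (cong (c * g zero +_) (sum-scale c (g ∘ suc))) (sym (*-distribˡ-+ c _ _))

card : ∀ {n} (p : Subset n) → ∣ p ∣ ≡ sum λ v → 𝟙 (v ∈? p)
card []            = refl
card (inside  ∷ p) = cong suc (trans (card p) (sum-cong-≗ λ v → 𝟙-cong (v ∈? p) (suc v ∈? inside ∷ p) there drop-there))
card (outside ∷ p) = trans (card p) (sum-cong-≗ λ v → 𝟙-cong (v ∈? p) (suc v ∈? outside ∷ p) there drop-there)

sum-bits-full : ∀ {n} (g : Fin n → ℕ) → (∀ v → g v ≤ 1) → n ≤ sum g → ∀ v → g v ≢ 0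
sum-bits-full {n} g g≤1 n≤ v gv≡0 = <-irrefl refl (≤-trans
  (subst (sum g <_) (sum-one n) (sum-strict g (λ _ → 1) g≤1 v (subst (_< 1) (sym gv≡0) z<s))) n≤)

-- One step of the leaf-counting loop, whose invariant is a sum truncated at the counter.
sum-below : ∀ {n} (g : Fin n → ℕ) (v : Fin n) →
  sum (λ w → 𝟙 (toℕ w <? suc (toℕ v)) * g w) ≡ g v + sum (λ w → 𝟙 (toℕ w <? toℕ v) * g w)
sum-below {n} g v = begin
  sum (λ w → 𝟙 (toℕ w <? suc (toℕ v)) * g w)                  ≡⟨ sum-cong-≗ split ⟩
  sum (λ w → 𝟙 (w F.≟ v) * g w + 𝟙 (toℕ w <? toℕ v) * g w)     ≡⟨ ∑-distrib-+ at below ⟩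
  sum at + sum below                                        ≡⟨ cong (_+ sum below) (sum-single at v λ w w≢v → cong (_* g w) (𝟙-no (w F.≟ v) w≢v)) ⟩
  𝟙 (v F.≟ v) * g v + sum below                               ≡⟨ cong (λ c → c * g v + sum below) (𝟙-yes (v F.≟ v) refl) ⟩
  1 * g v + sum below                                         ≡⟨ cong (_+ sum below) (*-identityˡ (g v)) ⟩
  g v + sum below                                             ∎
  where
  open ≡-Reasoning
  at below : Fin n → ℕ
  at w = 𝟙 (w F.≟ v) * g w
  below w = 𝟙 (toℕ w <? toℕ v) * g w
  split : ∀ w → 𝟙 (toℕ w <? suc (toℕ v)) * g w ≡ at w + below w
  split w with w F.≟ v | toℕ w <? toℕ v
  ... | yes refl | yes w<w = ⊥-elim (<-irrefl refl w<w)
  ... | yes refl | no  _   = trans (cong (_* g w) (𝟙-yes (toℕ w <? suc (toℕ w)) ≤-refl)) (sym (+-identityʳ _))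
  ... | no  w≢v  | yes w<v = cong (_* g w) (𝟙-yes (toℕ w <? suc (toℕ v)) (m<n⇒m<1+n w<v))
  ... | no  w≢v  | no  w≮v = cong (_* g w) (𝟙-no (toℕ w <? suc (toℕ v))
                               λ w≤v → w≮v (≤∧≢⇒< (s≤s⁻¹ w≤v) (w≢v ∘ toℕ-injective)))

-- If `w` were missed, punching it out of the codomain would inject `Fin (suc m)` into `Fin m`.
injective⇒hits : ∀ {m} (g : Fin m → Fin m) → Injective _≡_ _≡_ g → ∀ w → ∃[ v ] g v ≡ w
injective⇒hits {suc m} g inj w with any? (λ v → g v F.≟ w)
... | yes hit = hit
... | no miss = ⊥-elim (<-irrefl refl (injective⇒≤ {f = λ v → F.punchOut (missed v)}
                  (inj ∘ F.punchOut-injective (missed _) (missed _))))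
  where
  missed : ∀ v → w ≢ g v
  missed v w≡gv = miss (v , sym w≡gv)

-- Partitions into stars

Row : Set
Row = ℕ → ℕ

infix 8 _!_
_!_ : ∀ {n} → Row → Fin n → ℕ
r ! v = r (toℕ v)

set : ∀ {n} → Row → Fin n → ℕ → Row
set r v x = update r (toℕ v) x

set-same : ∀ {n} (r : Row) (v : Fin n) x → set r v x ! v ≡ x
set-same r v x = update-same r (toℕ v) x

set-other : ∀ {n} (r : Row) {v w : Fin n} x → w ≢ v → set r v x ! w ≡ r ! w
set-other r x w≢v = update-other r x (w≢v ∘ sym ∘ toℕ-injective)

-- A colouring κ marks v as free (0), as a leaf (1) or as a root (2).
module Stars {n : ℕ} (D : Digraph n) (f : Fin n → Fin n) (f-edge : ∀ v → D ⟨ f v ⟶ v ⟩) where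

  f≢ : ∀ v → f v ≢ v
  f≢ v fv≡v = loopless D v (subst (λ u → v ∈ N⁺ D u) fv≡v (f-edge v))

  -- `free-parent` keeps the future open: the parent of a free vertex is free or a root, so it can
  -- serve as a root when that vertex becomes a leaf.
  record Consistent (κ : Row) : Set where
    field
      colour      : ∀ (v : Fin n) → κ ! v ≤ 2
      leaf-parent : ∀ v → κ ! v ≡ 1 → κ ! f v ≡ 2
      free-parent : ∀ v → κ ! v ≡ 0 → κ ! f v ≢ 1

  open Consistent public

  data Colour (κ : Row) (v : Fin n) : Set where
    isFree : κ ! v ≡ 0 → Colour κ v
    isLeaf : κ ! v ≡ 1 → Colour κ v
    isRoot : κ ! v ≡ 2 → Colour κ v

  colourOf : ∀ {κ} → Consistent κ → ∀ v → Colour κ v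
  colourOf {κ} con v with κ ! v in κv | con .colour v
  ... | 0 | _ = isFree κv
  ... | 1 | _ = isLeaf κv
  ... | 2 | _ = isRoot κv
  ... | suc (suc (suc _)) | s≤s (s≤s ())

  Childless : Row → Fin n → Set
  Childless κ c = ∀ w → κ ! w ≡ 0 → f w ≢ c

  HasLeaf : Row → Fin n → Set
  HasLeaf κ u = ∃[ w ] κ ! w ≡ 1 × f w ≡ u

  infix 4 _⊑_
  -- Zero means "undecided" for colours, stamps and the output row alike, so this one order says for
  -- all three that decisions are never revised.
  record _⊑_ (κ κ′ : Row) : Set where
    constructor keeping
    field
      keeps : ∀ (v : Fin n) → κ ! v ≢ 0 → κ′ ! v ≡ κ ! v

  open _⊑_ public

  ⊑-refl : ∀ {κ} → κ ⊑ κ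
  ⊑-refl = keeping λ v _ → refl

  ⊑-trans : ∀ {κ κ′ κ″} → κ ⊑ κ′ → κ′ ⊑ κ″ → κ ⊑ κ″
  ⊑-trans le le′ = keeping λ v v≢0 →
    trans (le′ .keeps v (v≢0 ∘ trans (sym (le .keeps v v≢0)))) (le .keeps v v≢0)

  ⊑-free : ∀ {κ κ′} → κ ⊑ κ′ → ∀ v → κ′ ! v ≡ 0 → κ ! v ≡ 0
  ⊑-free {κ} le v v≡0 with κ ! v ≟ 0
  ... | yes z = z
  ... | no nz = trans (sym (le .keeps v nz)) v≡0

  ⊑-leaf : ∀ {κ κ′} → κ ⊑ κ′ → ∀ {v : Fin n} → κ ! v ≡ 1 → κ′ ! v ≡ 1
  ⊑-leaf le {v} κv = trans (le .keeps v λ z → contradiction (trans (sym z) κv) λ ()) κv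

  ⊑-root : ∀ {κ κ′} → κ ⊑ κ′ → ∀ {v : Fin n} → κ ! v ≡ 2 → κ′ ! v ≡ 2
  ⊑-root le {v} κv = trans (le .keeps v λ z → contradiction (trans (sym z) κv) λ ()) κv

  HasLeaf-mono : ∀ {κ κ′} → κ ⊑ κ′ → ∀ {u} → HasLeaf κ u → HasLeaf κ′ u
  HasLeaf-mono le (w , leafw , fw) = w , ⊑-leaf le leafw , fw

  colouredBit : Row → Fin n → ℕ
  colouredBit κ v = 1 ∸ 𝟙 (κ ! v ≟ 0)

  coloured : Row → ℕ
  coloured κ = sum (colouredBit κ)

  coloured-strict : ∀ {κ κ′} → κ ⊑ κ′ → ∀ (z : Fin n) → κ ! z ≡ 0 → κ′ ! z ≢ 0 →
    coloured κ < coloured κ′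
  coloured-strict {κ} {κ′} le z κz κ′z = sum-strict (colouredBit κ) (colouredBit κ′)
    (λ v → ∸-monoʳ-≤ 1 (𝟙-mono (κ′ ! v ≟ 0) (κ ! v ≟ 0) (⊑-free le v))) z
    (≤-reflexive (trans (cong (λ b → suc (1 ∸ b)) (𝟙-yes (κ ! z ≟ 0) κz)) (cong (1 ∸_) (sym (𝟙-no (κ′ ! z ≟ 0) κ′z)))))

  all-coloured : ∀ κ → n ≤ coloured κ → ∀ (v : Fin n) → κ ! v ≢ 0
  all-coloured κ n≤ v κv = sum-bits-full (colouredBit κ) (λ w → m∸n≤m 1 (𝟙 (κ ! w ≟ 0))) n≤ v
    (cong (1 ∸_) (𝟙-yes (κ ! v ≟ 0) κv))

  colourRoot : Row → Fin n → Row
  colourRoot κ p = set κ p 2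

  settle : Row → Fin n → Row
  settle κ c = set (set κ c 1) (f c) 2

  settle-leaf : ∀ κ c → settle κ c ! c ≡ 1
  settle-leaf κ c = trans (set-other (set κ c 1) 2 (f≢ c ∘ sym)) (set-same κ c 1)

  settle-root : ∀ κ c → settle κ c ! f c ≡ 2
  settle-root κ c = set-same (set κ c 1) (f c) 2

  settle-rest : ∀ κ c {v} → v ≢ c → v ≢ f c → settle κ c ! v ≡ κ ! v
  settle-rest κ c v≢c v≢fc = trans (set-other (set κ c 1) 2 v≢fc) (set-other κ 1 v≢c)

  module _ {κ : Row} (con : Consistent κ) {c : Fin n} (cfree : κ ! c ≡ 0) where

    settle-⊑ : κ ⊑ settle κ c
    settle-⊑ .keeps v κv with v F.≟ c | v F.≟ f c
    ... | yes refl | _ = ⊥-elim (κv cfree)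
    ... | no v≢c | no v≢fc = settle-rest κ c v≢c v≢fc
    ... | no v≢c | yes refl with colourOf con (f c)
    ...   | isFree κfc = ⊥-elim (κv κfc)
    ...   | isLeaf κfc = ⊥-elim (con .free-parent c cfree κfc)
    ...   | isRoot κfc = trans (settle-root κ c) (sym κfc)

    -- Childlessness protects `free-parent`: a free child of `c` would be left with a leaf as its
    -- parent.
    settle-consistent : Childless κ c → Consistent (settle κ c)
    settle-consistent childless .colour v with v F.≟ c | v F.≟ f c
    ... | yes refl | _        = ≤-trans (≤-reflexive (settle-leaf κ c)) (n≤1+n 1)
    ... | no _     | yes refl = ≤-reflexive (settle-root κ c)
    ... | no v≢c   | no v≢fc  = subst (_≤ 2) (sym (settle-rest κ c v≢c v≢fc)) (con .colour v)
    settle-consistent childless .leaf-parent v leafv with v F.≟ c | v F.≟ f c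
    ... | yes refl | _        = settle-root κ c
    ... | no _     | yes refl = contradiction (trans (sym leafv) (settle-root κ c)) λ ()
    ... | no v≢c   | no v≢fc  =
      ⊑-root settle-⊑ (con .leaf-parent v (trans (sym (settle-rest κ c v≢c v≢fc)) leafv))
    settle-consistent childless .free-parent v freev leafp with f v F.≟ c | f v F.≟ f c
    ... | yes fv≡c | _ = childless v (⊑-free settle-⊑ v freev) fv≡c
    ... | no _ | yes fv≡fc = contradiction (trans (sym (settle-root κ c)) (trans (cong (settle κ c !_) (sym fv≡fc)) leafp)) λ ()
    ... | no fv≢c | no fv≢fc = con .free-parent v (⊑-free settle-⊑ v freev)
                                 (trans (sym (settle-rest κ c fv≢c fv≢fc)) leafp)

    settle-new : ∀ v → settle κ c ! v ≡ 0 → v ≢ c × v ≢ f c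
    settle-new v v≡0 = (λ { refl → contradiction (trans (sym v≡0) (settle-leaf κ c)) λ () })
                     , (λ { refl → contradiction (trans (sym v≡0) (settle-root κ c)) λ () })

    settle-HasLeaf : HasLeaf (settle κ c) (f c)
    settle-HasLeaf = c , settle-leaf κ c , refl

  module _ {κ : Row} (con : Consistent κ) {x : Fin n} (xfree : κ ! x ≡ 0) where

    colourRoot-⊑ : κ ⊑ colourRoot κ x
    colourRoot-⊑ .keeps v κv = set-other κ {x} 2 λ { refl → κv xfree }

    colourRoot-consistent : Consistent (colourRoot κ x)
    colourRoot-consistent .colour v with v F.≟ x
    ... | yes refl = ≤-reflexive (set-same κ x 2)
    ... | no v≢x   = subst (_≤ 2) (sym (set-other κ 2 v≢x)) (con .colour v)
    colourRoot-consistent .leaf-parent v leafv with v F.≟ x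
    ... | yes refl = contradiction (trans (sym leafv) (set-same κ x 2)) λ ()
    ... | no v≢x   = ⊑-root colourRoot-⊑ (con .leaf-parent v (trans (sym (set-other κ 2 v≢x)) leafv))
    colourRoot-consistent .free-parent v freev leafp with f v F.≟ x
    ... | yes refl = contradiction (trans (sym leafp) (set-same κ (f v) 2)) λ ()
    ... | no fv≢x  = con .free-parent v (⊑-free colourRoot-⊑ v freev) (trans (sym (set-other κ 2 fv≢x)) leafp)

  Stuck : Row → Set
  Stuck κ = ∀ v → κ ! v ≡ 0 → ∃[ w ] κ ! w ≡ 0 × f w ≡ v

  module Permutation (κ : Row) (stuck : Stuck κ) where

    -- A chosen free child for each free vertex, the identity elsewhere. On free vertices `f` undoes
    -- it, so it is injective and hence onto: each free vertex is the chosen child of a free vertex.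
    -- Therefore `f` restricted to the free vertices is the inverse permutation.
    section : Fin n → Fin n
    section v with κ ! v ≟ 0
    ... | yes κv = stuck v κv .proj₁
    ... | no _   = v

    section-injective : Injective _≡_ _≡_ section
    section-injective {v} {w} same with κ ! v ≟ 0 | κ ! w ≟ 0
    ... | yes κv | yes κw = trans (sym (stuck v κv .proj₂ .proj₂)) (trans (cong f same) (stuck w κw .proj₂ .proj₂))
    ... | yes κv | no κw  = ⊥-elim (κw (subst (λ u → κ ! u ≡ 0) same (stuck v κv .proj₂ .proj₁)))
    ... | no κv  | yes κw = ⊥-elim (κv (subst (λ u → κ ! u ≡ 0) (sym same) (stuck w κw .proj₂ .proj₁)))
    ... | no _   | no _   = same

    section-free : ∀ v → κ ! section v ≡ 0 → κ ! v ≡ 0 × f (section v) ≡ v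
    section-free v κs with κ ! v ≟ 0
    ... | yes κv = κv , stuck v κv .proj₂ .proj₂
    ... | no κv  = ⊥-elim (κv κs)

  module _ (κ : Row) (stuck : Stuck κ) where
    open Permutation κ stuck

    stuck-closed : ∀ w → κ ! w ≡ 0 → κ ! f w ≡ 0
    stuck-closed w κw with v , refl ← injective⇒hits section section-injective w
      with κv , fs ← section-free v κw = trans (cong (κ !_) fs) κv

    stuck-injective : ∀ {w w′} → κ ! w ≡ 0 → κ ! w′ ≡ 0 → f w ≡ f w′ → w ≡ w′
    stuck-injective {w} {w′} κw κw′ same
      with v , refl ← injective⇒hits section section-injective w
         | v′ , refl ← injective⇒hits section section-injective w′
      = cong section (trans (sym (section-free v κw .proj₂)) (trans same (section-free v′ κw′ .proj₂)))

-- Invariants of stripping and of walking along a cycle; leaf counts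

module Invariants {n : ℕ} (D : Digraph n) (f : Fin n → Fin n) (f-edge : ∀ v → D ⟨ f v ⟶ v ⟩) where
  open Stars D f f-edge public

  FreeChild : Row → Fin n → Set
  FreeChild κ v = ∃[ w ] κ ! w ≡ 0 × f w ≡ v

  Childless-mono : ∀ {κ κ′} → κ ⊑ κ′ → ∀ v → Childless κ v → Childless κ′ v
  Childless-mono le v childless w κ′w = childless w (⊑-free le w κ′w)

  -- `E` collects the roots allowed to be leafless: none during stripping, in addition the start of
  -- the walk during a walk, and the orphans once cycles are being broken.
  RootsOf : (Fin n → Set) → Row → Set
  RootsOf E κ = ∀ u → κ ! u ≡ 2 → HasLeaf κ u ⊎ E u

  settle-RootsOf : ∀ {E κ} → Consistent κ → ∀ {c} → κ ! c ≡ 0 → RootsOf E κ → RootsOf E (settle κ c)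
  settle-RootsOf {κ = κ} con {c} cfree roots u rootu with u F.≟ c | u F.≟ f c
  ... | yes refl | _ = contradiction (trans (sym rootu) (settle-leaf κ c)) λ ()
  ... | no _ | yes refl = inj₁ (settle-HasLeaf con cfree)
  ... | no u≢c | no u≢fc with roots u (trans (sym (settle-rest κ c u≢c u≢fc)) rootu)
  ...   | inj₁ has = inj₁ (HasLeaf-mono (settle-⊑ con cfree) has)
  ...   | inj₂ e   = inj₂ e

  -- A round that starts from `κ₀`, after `i` vertices. By `progress` the round either has changed
  -- nothing, and then certifies `Stuck κ₀` at its end, or has coloured at least one vertex.
  record Stripping (κ₀ : Row) (i : ℕ) (κ : Row) : Set where
    field
      consistent : Consistent κ
      roots      : RootsOf (λ _ → ⊥) κ
      extends    : κ₀ ⊑ κ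
      progress   : ((∀ (v : Fin n) → κ ! v ≡ κ₀ ! v) × (∀ v → toℕ v < i → κ₀ ! v ≡ 0 → FreeChild κ₀ v))
                 ⊎ (∃[ z ] κ₀ ! z ≡ 0 × Childless κ₀ z × κ ! z ≢ 0)

  module _ {κ₀ κ : Row} (v : Fin n) where

    -- Childlessness is judged by the colouring at the start of the round. This outdated information
    -- is safe, because free children can only disappear during the round.
    stripping-settle : Stripping κ₀ (toℕ v) κ → κ ! v ≡ 0 → Childless κ₀ v →
      Stripping κ₀ (suc (toℕ v)) (settle κ v)
    stripping-settle s free childless = record
      { consistent = settle-consistent consistent free (Childless-mono extends v childless)
      ; roots      = settle-RootsOf consistent free roots
      ; extends    = ⊑-trans extends (settle-⊑ consistent free)
      ; progress   = inj₂ (v , ⊑-free extends v free , childless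
                          , λ z → contradiction (trans (sym z) (settle-leaf κ v)) λ ())
      }
      where open Stripping s

    stripping-skip : Stripping κ₀ (toℕ v) κ → (κ ! v ≡ 0 → FreeChild κ₀ v) →
      Stripping κ₀ (suc (toℕ v)) κ
    stripping-skip s child = record
      { consistent = consistent ; roots = roots ; extends = extends ; progress = next-progress progress }
      where
      open Stripping s
      next-progress : _ → _
      next-progress (inj₂ made) = inj₂ made
      next-progress (inj₁ (same , seen)) = inj₁ (same , seen′)
        where
        seen′ : ∀ w → toℕ w < suc (toℕ v) → κ₀ ! w ≡ 0 → FreeChild κ₀ w
        seen′ w w≤v κ₀w with w F.≟ v
        ... | yes refl = child (trans (same w) κ₀w)
        ... | no w≢v   = seen w (≤∧≢⇒< (s≤s⁻¹ w≤v) (w≢v ∘ toℕ-injective)) κ₀w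

  -- The alternative carried from round to round: stripping has halted, or every round so far has
  -- coloured a new vertex. After `n` rounds the second case leaves no free vertex and is thus also
  -- stuck.
  stripping-end : ∀ {κ₀ κ} → Stripping κ₀ n κ → ∀ {i} → Stuck κ₀ ⊎ i ≤ coloured κ₀ →
    Stuck κ ⊎ suc i ≤ coloured κ
  stripping-end {κ₀} {κ} s before with s .Stripping.progress | before
  ... | inj₁ (same , seen) | _ = inj₁ λ v κv →
        let w , κ₀w , fw = seen v (toℕ<n v) (trans (sym (same v)) κv) in w , trans (same w) κ₀w , fw
  ... | inj₂ (z , κ₀z , childless , κz) | inj₁ stuck =
        let w , κ₀w , fw = stuck z κ₀z in ⊥-elim (childless w κ₀w fw)
  ... | inj₂ (z , κ₀z , childless , κz) | inj₂ i≤ =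
        inj₂ (≤-trans (s≤s i≤) (coloured-strict (s .Stripping.extends) z κ₀z κz))

  coloured-stuck : ∀ κ → Stuck κ ⊎ n ≤ coloured κ → Stuck κ
  coloured-stuck κ (inj₁ stuck) = stuck
  coloured-stuck κ (inj₂ full)  = λ v κv → ⊥-elim (all-coloured κ full v κv)

  -- The walk colours the f-orbit of x alternately; y is the root reached last.
  record Walking (E : Fin n → Set) (κ₀ κ : Row) (x y : Fin n) : Set where
    field
      consistent : Consistent κ
      roots      : RootsOf (λ u → E u ⊎ u ≡ x) κ
      extends    : κ₀ ⊑ κ
      onCycle    : κ₀ ! y ≡ 0
      visited    : κ ! y ≢ 0
      started    : κ ! x ≢ 0
      nearlyStuck : ∀ z → κ ! z ≡ 0 → z ≢ f y → FreeChild κ z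

  walking-start : ∀ {E κ₀} → Consistent κ₀ → RootsOf E κ₀ → Stuck κ₀ → ∀ {x} → κ₀ ! x ≡ 0 →
    Walking E κ₀ (colourRoot κ₀ x) x x
  walking-start {E} {κ₀} con roots₀ stuck {x} xfree = record
    { consistent  = colourRoot-consistent con xfree
    ; roots       = roots′
    ; extends     = colourRoot-⊑ con xfree
    ; onCycle     = xfree
    ; visited     = x≢0
    ; started     = x≢0
    ; nearlyStuck = near
    }
    where
    x≢0 : colourRoot κ₀ x ! x ≢ 0
    x≢0 z = contradiction (trans (sym z) (set-same κ₀ x 2)) λ ()
    roots′ : RootsOf (λ u → E u ⊎ u ≡ x) (colourRoot κ₀ x)
    roots′ u rootu with u F.≟ x
    ... | yes u≡x = inj₂ (inj₂ u≡x)
    ... | no u≢x with roots₀ u (trans (sym (set-other κ₀ 2 u≢x)) rootu)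
    ...   | inj₁ has = inj₁ (HasLeaf-mono (colourRoot-⊑ con xfree) has)
    ...   | inj₂ e   = inj₂ (inj₁ e)
    near : ∀ z → colourRoot κ₀ x ! z ≡ 0 → z ≢ f x → FreeChild (colourRoot κ₀ x) z
    near z z≡0 z≢fx with w , κ₀w , fw ← stuck z (⊑-free (colourRoot-⊑ con xfree) z z≡0) =
      w , trans (set-other κ₀ {x} 2 λ { refl → z≢fx (sym fw) }) κ₀w , fw

  -- `f y` has lost its only free child: `f` is injective on the vertices free in `κ₀`, so that
  -- child could only be `y`, which is coloured. If `f (f y)` is `x` again, the cycle is even and
  -- `x` has just received a leaf; on an odd cycle the walk ends with `f y` equal to `x`, still
  -- leafless.
  walking-step : ∀ {E κ₀ κ x y} → Stuck κ₀ → Walking E κ₀ κ x y → κ ! f y ≡ 0 →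
    Walking E κ₀ (settle κ (f y)) x (f (f y))
  walking-step {E} {κ₀} {κ} {x} {y} stuck walk free = record
    { consistent  = settle-consistent consistent free childless
    ; roots       = settle-RootsOf consistent free roots
    ; extends     = ⊑-trans extends (settle-⊑ consistent free)
    ; onCycle     = stuck-closed κ₀ stuck (f y) (stuck-closed κ₀ stuck y onCycle)
    ; visited     = λ z → contradiction (trans (sym z) (settle-root κ (f y))) λ ()
    ; started     = started ∘ ⊑-free (settle-⊑ consistent free) x
    ; nearlyStuck = near
    }
    where
    open Walking walk
    childless : Childless κ (f y)
    childless w κw fw≡fy = visited (subst (λ u → κ ! u ≡ 0)
      (stuck-injective κ₀ stuck (⊑-free extends w κw) onCycle fw≡fy) κw)
    near : ∀ z → settle κ (f y) ! z ≡ 0 → z ≢ f (f (f y)) → FreeChild (settle κ (f y)) z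
    near z z≡0 z≢ with z≢c , z≢fc ← settle-new consistent free z z≡0
      with w , κw , fw ← nearlyStuck z (⊑-free (settle-⊑ consistent free) z z≡0) z≢c
      = w , trans (settle-rest κ (f y) (λ { refl → z≢fc (sym fw) }) (λ { refl → z≢ (sym fw) })) κw , fw

  walking-stuck : ∀ {E κ₀ κ x y} → Walking E κ₀ κ x y → κ ! f y ≢ 0 → Stuck κ
  walking-stuck walk fy z κz = walk .Walking.nearlyStuck z κz λ { refl → fy κz }

  leafOf? : ∀ κ (u w : Fin n) → Dec (κ ! w ≡ 1 × f w ≡ u)
  leafOf? κ u w = (κ ! w ≟ 1) ×-dec (f w F.≟ u)

  leaves : Row → Fin n → ℕ
  leaves κ u = sum λ w → 𝟙 (leafOf? κ u w)

  leaves-cong : ∀ κ κ′ u → (∀ w → f w ≡ u → κ ! w ≡ 1 → κ′ ! w ≡ 1) → leaves κ u ≤ leaves κ′ u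
  leaves-cong κ κ′ u h = sum-mono _ _ λ w →
    𝟙-mono (leafOf? κ u w) (leafOf? κ′ u w) λ { (leafw , fw) → h w fw leafw , fw }

  leaves-mono : ∀ {κ κ′} → κ ⊑ κ′ → ∀ u → leaves κ u ≤ leaves κ′ u
  leaves-mono {κ} {κ′} le u = leaves-cong κ κ′ u λ w _ → ⊑-leaf le

  HasLeaf⇒leaves : ∀ κ {u} → HasLeaf κ u → 1 ≤ leaves κ u
  HasLeaf⇒leaves κ {u} (w , leafw , fw) = ≤-trans
    (≤-reflexive (sym (𝟙-yes (leafOf? κ u w) (leafw , fw)))) (term≤sum (λ w → 𝟙 (leafOf? κ u w)) w)

  leaves⇒HasLeaf : ∀ κ u → 1 ≤ leaves κ u → HasLeaf κ u
  leaves⇒HasLeaf κ u 1≤ with any? (leafOf? κ u)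
  ... | yes has = has
  ... | no none = contradiction (subst (1 ≤_) (sum-zero (λ w → 𝟙 (leafOf? κ u w))
                    λ w → 𝟙-no (leafOf? κ u w) λ l → none (w , l)) 1≤) λ ()

  leaves≤1 : ∀ κ u → (∀ w w′ → κ ! w ≡ 1 → κ ! w′ ≡ 1 → f w ≡ u → f w′ ≡ u → w ≡ w′) → leaves κ u ≤ 1
  leaves≤1 κ u unique with any? (leafOf? κ u)
  ... | no none = subst (_≤ 1) (sym (sum-zero (λ w → 𝟙 (leafOf? κ u w))
                    λ w → 𝟙-no (leafOf? κ u w) λ l → none (w , l))) z≤n
  ... | yes (w , leafw , fw) = subst (_≤ 1) (sym (sum-single (λ w → 𝟙 (leafOf? κ u w)) w
                    λ v v≢w → 𝟙-no (leafOf? κ u v) λ { (leafv , fv) → v≢w (unique v w leafv leafw fv fw) }))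
                    (𝟙≤1 (leafOf? κ u w))

  HasLeaf-root : ∀ {κ} → Consistent κ → ∀ {u} → HasLeaf κ u → κ ! u ≡ 2
  HasLeaf-root con (w , leafw , refl) = con .leaf-parent w leafw

  module _ {κ₀ κ : Row} (con₀ : Consistent κ₀) (stuck : Stuck κ₀) (le : κ₀ ⊑ κ) where

    private
      fresh : ∀ w → κ ! w ≡ 1 → κ₀ ! w ≢ 1 → κ₀ ! w ≡ 0
      fresh w leafw old with colourOf con₀ w
      ... | isFree z = z
      ... | isLeaf o = ⊥-elim (old o)
      ... | isRoot r = contradiction (trans (sym leafw) (⊑-root le r)) λ ()

    -- A leaf acquired after `κ₀` was free in `κ₀`, and then so was its parent by `stuck-closed`.
    leaves-off-cycles : ∀ u → κ₀ ! u ≢ 0 → leaves κ u ≤ leaves κ₀ u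
    leaves-off-cycles u u≢0 = leaves-cong κ κ₀ u old
      where
      old : ∀ w → f w ≡ u → κ ! w ≡ 1 → κ₀ ! w ≡ 1
      old w refl leafw with κ₀ ! w ≟ 1
      ... | yes l = l
      ... | no ¬l = ⊥-elim (u≢0 (stuck-closed κ₀ stuck w (fresh w leafw ¬l)))

    -- A vertex free in `κ₀` has no leaf there, and `f` is injective on the free vertices, so at
    -- most one leaf can be added.
    leaves-on-cycles : ∀ u → κ₀ ! u ≡ 0 → leaves κ u ≤ 1
    leaves-on-cycles u u≡0 = leaves≤1 κ u λ w w′ leafw leafw′ fw fw′ →
      stuck-injective κ₀ stuck (new w leafw fw) (new w′ leafw′ fw′) (trans fw (sym fw′))
      where
      new : ∀ w → κ ! w ≡ 1 → f w ≡ u → κ₀ ! w ≡ 0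
      new w leafw refl = fresh w leafw λ l → contradiction (trans (sym u≡0) (con₀ .leaf-parent w l)) λ ()

  leaves≤outdegree : ∀ κ u → leaves κ u ≤ outdegree D u
  leaves≤outdegree κ u = subst (leaves κ u ≤_) (sym (card (N⁺ D u)))
    (sum-mono _ _ λ w → 𝟙-mono (leafOf? κ u w) (w ∈? N⁺ D u) λ { (_ , refl) → f-edge w })

-- Greedy selection

-- A stamp 0 means "not selected"; otherwise stamps increase in the order of selection.
module Selection {n : ℕ} (D : Digraph n) (f : Fin n → Fin n) (f-edge : ∀ v → D ⟨ f v ⟶ v ⟩) where
  open Invariants D f f-edge public

  Dominates : Row → Fin n → Fin n → Set
  Dominates σ t u = σ ! t ≢ 0 × D ⟨ t ⟶ u ⟩

  Dominated : Row → Fin n → Set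
  Dominated σ u = ∃[ t ] Dominates σ t u

  Dominated-mono : ∀ {σ σ′} → σ ⊑ σ′ → ∀ {u} → Dominated σ u → Dominated σ′ u
  Dominated-mono le (t , t≢0 , edge) = t , (t≢0 ∘ ⊑-free le t) , edge

  -- `backward` records that only undominated vertices are selected: an edge from an earlier to a
  -- later one would have prevented the later choice. `distinct` lets the backward scan meet one
  -- vertex per stamp.
  record Stamped (σ : Row) (c : ℕ) : Set where
    field
      bounded  : ∀ (v : Fin n) → σ ! v ≤ c
      backward : ∀ u v → σ ! u ≢ 0 → σ ! v ≢ 0 → D ⟨ u ⟶ v ⟩ → σ ! v < σ ! u
      distinct : ∀ (u v : Fin n) → σ ! u ≢ 0 → σ ! u ≡ σ ! v → u ≡ v

  open Stamped public

  stamped-tick : ∀ {σ c} → Stamped σ c → Stamped σ (suc c)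
  stamped-tick st .bounded v = m≤n⇒m≤1+n (st .bounded v)
  stamped-tick st .backward  = st .backward
  stamped-tick st .distinct  = st .distinct

  select-⊑ : ∀ σ {v : Fin n} c → σ ! v ≡ 0 → σ ⊑ set σ v c
  select-⊑ σ {v} c v≡0 .keeps w w≢0 = set-other σ {v} c λ { refl → w≢0 v≡0 }

  module _ {σ : Row} {c : ℕ} (st : Stamped σ c) (v : Fin n) where

    private
      later : ∀ {u} → u ≢ v → σ ! u ≢ suc c
      later {u} _ u≡ = <-irrefl refl (≤-trans (≤-reflexive (sym u≡)) (st .bounded u))

    stamped-select : ¬ Dominated σ v → Stamped (set σ v (suc c)) (suc c)
    stamped-select ¬dom .bounded u with u F.≟ v
    ... | yes refl = ≤-reflexive (set-same σ v (suc c))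
    ... | no u≢v   = ≤-trans (≤-reflexive (set-other σ (suc c) u≢v)) (m≤n⇒m≤1+n (st .bounded u))
    stamped-select ¬dom .backward u w u≢0 w≢0 edge with u F.≟ v | w F.≟ v
    ... | yes refl | yes refl = ⊥-elim (loopless D u edge)
    ... | yes refl | no w≢v = subst₂ _<_ (sym (set-other σ (suc c) w≢v)) (sym (set-same σ v (suc c))) (s≤s (st .bounded w))
    ... | no u≢v | yes refl = ⊥-elim (¬dom (u , u≢0 ∘ trans (set-other σ (suc c) u≢v) , edge))
    ... | no u≢v | no w≢v = subst₂ _<_ (sym (set-other σ (suc c) w≢v)) (sym (set-other σ (suc c) u≢v))
          (st .backward u w (u≢0 ∘ trans (set-other σ (suc c) u≢v)) (w≢0 ∘ trans (set-other σ (suc c) w≢v)) edge)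
    stamped-select ¬dom .distinct u w u≢0 same with u F.≟ v | w F.≟ v
    ... | yes refl | yes refl = refl
    ... | yes refl | no w≢v = ⊥-elim (later w≢v (trans (sym (set-other σ (suc c) w≢v)) (trans (sym same) (set-same σ v (suc c)))))
    ... | no u≢v | yes refl = ⊥-elim (later u≢v (trans (sym (set-other σ (suc c) u≢v)) (trans same (set-same σ v (suc c)))))
    ... | no u≢v | no w≢v = st .distinct u w (u≢0 ∘ trans (set-other σ (suc c) u≢v))
          (trans (sym (set-other σ (suc c) u≢v)) (trans same (set-other σ (suc c) w≢v)))

  -- The comparison of leaf counts is what later permits charging the star of `u` to its dominator
  -- `t`.
  Covered : Row → Row → Fin n → Set
  Covered κ σ u = σ ! u ≢ 0 ⊎ (∃[ t ] Dominates σ t u × leaves κ u ≤ leaves κ t)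

  Covered-mono : ∀ {κ σ σ′} → σ ⊑ σ′ → ∀ {u} → Covered κ σ u → Covered κ σ′ u
  Covered-mono le {u} (inj₁ u≢0) = inj₁ (u≢0 ∘ ⊑-free le u)
  Covered-mono le (inj₂ (t , (t≢0 , edge) , t≥u)) = inj₂ (t , (t≢0 ∘ ⊑-free le t , edge) , t≥u)

  record Swept (κ : Row) (k : ℕ) (σ : Row) : Set where
    field
      rich    : ∀ t → σ ! t ≢ 0 → k ≤ leaves κ t
      covered : ∀ u → k ≤ leaves κ u → Covered κ σ u

  -- `recent` later separates T from the rest of S by their stamps. In `covered`, the alternative
  -- `k < leaves κ u` hands on what the sweeps with larger thresholds have achieved.
  record Sweeping (κ : Row) (k : ℕ) (σ₀ : Row) (c₀ i : ℕ) (σ : Row) (c : ℕ) : Set where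
    field
      clock   : c ≡ c₀ + i
      stamped : Stamped σ c
      extends : σ₀ ⊑ σ
      recent  : ∀ (v : Fin n) → σ₀ ! v ≡ 0 → σ ! v ≢ 0 → c₀ < σ ! v
      rich    : ∀ t → σ ! t ≢ 0 → k ≤ leaves κ t
      covered : ∀ u → k ≤ leaves κ u → k < leaves κ u ⊎ toℕ u < i → Covered κ σ u

  sweeping-start : ∀ {κ k σ c} → Stamped σ c → (∀ t → σ ! t ≢ 0 → k ≤ leaves κ t) →
    (∀ u → k < leaves κ u → Covered κ σ u) → Sweeping κ k σ c 0 σ c
  sweeping-start {c = c} st rich cov = record
    { clock   = sym (+-identityʳ c)
    ; stamped = st
    ; extends = ⊑-refl
    ; recent  = λ v v≡0 v≢0 → ⊥-elim (v≢0 v≡0)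
    ; rich    = rich
    ; covered = λ { u _ (inj₁ k<) → cov u k< ; u _ (inj₂ ()) }
    }

  sweeping-end : ∀ {κ k σ₀ c₀ σ c} → Sweeping κ k σ₀ c₀ n σ c → Swept κ k σ
  sweeping-end s = record { rich = rich ; covered = λ u k≤ → covered u k≤ (inj₂ (toℕ<n u)) }
    where open Sweeping s

  module _ {κ k σ₀ c₀ σ c} (v : Fin n) (s : Sweeping κ k σ₀ c₀ (toℕ v) σ c) where
    open Sweeping s

    private
      tick : suc c ≡ c₀ + suc (toℕ v)
      tick = trans (cong suc clock) (sym (+-suc c₀ (toℕ v)))

    sweeping-select : k ≤ leaves κ v → ¬ Dominated σ v → σ ! v ≡ 0 →
      Sweeping κ k σ₀ c₀ (suc (toℕ v)) (set σ v (suc c)) (suc c)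
    sweeping-select k≤ ¬dom v≡0 = record
      { clock   = tick
      ; stamped = stamped-select stamped v ¬dom
      ; extends = ⊑-trans extends le
      ; recent  = recent′
      ; rich    = rich′
      ; covered = covered′
      }
      where
      le = select-⊑ σ (suc c) v≡0
      recent′ : ∀ w → σ₀ ! w ≡ 0 → set σ v (suc c) ! w ≢ 0 → c₀ < set σ v (suc c) ! w
      recent′ w w₀ w≢0 with w F.≟ v
      ... | yes refl = subst (c₀ <_) (sym (set-same σ v (suc c))) (s≤s (subst (c₀ ≤_) (sym clock) (m≤m+n c₀ _)))
      ... | no w≢v   = subst (c₀ <_) (sym (set-other σ (suc c) w≢v)) (recent w w₀ (w≢0 ∘ trans (set-other σ (suc c) w≢v)))
      rich′ : ∀ t → set σ v (suc c) ! t ≢ 0 → k ≤ leaves κ t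
      rich′ t t≢0 with t F.≟ v
      ... | yes refl = k≤
      ... | no t≢v   = rich t (t≢0 ∘ trans (set-other σ (suc c) t≢v))
      covered′ : ∀ u → k ≤ leaves κ u → k < leaves κ u ⊎ toℕ u < suc (toℕ v) → Covered κ (set σ v (suc c)) u
      covered′ u k≤u why with u F.≟ v
      ... | yes refl = inj₁ λ z → contradiction (trans (sym z) (set-same σ v (suc c))) λ ()
      ... | no u≢v   = Covered-mono {κ} le (covered u k≤u
            ([ inj₁ , (λ u≤v → inj₂ (≤∧≢⇒< (s≤s⁻¹ u≤v) (u≢v ∘ toℕ-injective))) ]′ why))

    -- Only vertices with exactly `k` leaves are new to this sweep. Every selected dominator has at
    -- least `k` leaves by `rich`, so for them domination alone gives `Covered`.
    sweeping-skip : (k ≤ leaves κ v → Dominated σ v ⊎ σ ! v ≢ 0) →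
      Sweeping κ k σ₀ c₀ (suc (toℕ v)) σ (suc c)
    sweeping-skip why-not = record
      { clock   = tick
      ; stamped = stamped-tick stamped
      ; extends = extends
      ; recent  = recent
      ; rich    = rich
      ; covered = covered′
      }
      where
      covered′ : ∀ u → k ≤ leaves κ u → k < leaves κ u ⊎ toℕ u < suc (toℕ v) → Covered κ σ u
      covered′ u k≤u (inj₁ k<u) = covered u k≤u (inj₁ k<u)
      covered′ u k≤u (inj₂ u≤v) with m≤n⇒m<n∨m≡n k≤u
      ... | inj₁ k<u = covered u k≤u (inj₁ k<u)
      ... | inj₂ k≡u with u F.≟ v
      ...   | no u≢v = covered u k≤u (inj₂ (≤∧≢⇒< (s≤s⁻¹ u≤v) (u≢v ∘ toℕ-injective)))
      ...   | yes refl with why-not k≤u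
      ...     | inj₂ u≢0 = inj₁ u≢0
      ...     | inj₁ (t , t≢0 , edge) =
                inj₂ (t , (t≢0 , edge) , subst (_≤ leaves κ t) k≡u (rich t t≢0))

  -- All selected vertices with stamp above `c` have been decided. Going downwards in the stamps
  -- suits `backward`: the vertex examined next has no edge to a vertex already chosen, so
  -- independence only requires that no chosen vertex dominates it.
  record Peeling (σ : Row) (c : ℕ) (q : Row) : Set where
    field
      bit         : ∀ (v : Fin n) → q ! v ≤ 1
      selected    : ∀ (v : Fin n) → q ! v ≢ 0 → c < σ ! v
      independent : ∀ u v → q ! u ≢ 0 → q ! v ≢ 0 → ¬ D ⟨ u ⟶ v ⟩
      absorbed    : ∀ v → c < σ ! v → q ! v ≢ 0 ⊎ Dominated q v

  peeling-start : ∀ {σ c q} → Stamped σ c → (∀ (v : Fin n) → q ! v ≡ 0) → Peeling σ c q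
  peeling-start st q≡0 = record
    { bit         = λ v → ≤-trans (≤-reflexive (q≡0 v)) z≤n
    ; selected    = λ v v≢0 → ⊥-elim (v≢0 (q≡0 v))
    ; independent = λ u v u≢0 → ⊥-elim (u≢0 (q≡0 u))
    ; absorbed    = λ v c<v → ⊥-elim (<⇒≱ c<v (st .bounded v))
    }

  module _ {σ c₀ c q} (st : Stamped σ c₀) (p : Peeling σ (suc c) q) where
    open Peeling p

    peeling-select : ∀ (x : Fin n) → σ ! x ≡ suc c → ¬ Dominated q x → Peeling σ c (set q x 1)
    peeling-select x x≡ ¬dom = record
      { bit = bit′ ; selected = selected′ ; independent = independent′ ; absorbed = absorbed′ }
      where
      σx≢0 : σ ! x ≢ 0
      σx≢0 z = contradiction (trans (sym x≡) z) λ ()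
      old : ∀ {v} → v ≢ x → set q x 1 ! v ≢ 0 → q ! v ≢ 0
      old v≢x v≢0 = v≢0 ∘ trans (set-other q 1 v≢x)
      bit′ : ∀ v → set q x 1 ! v ≤ 1
      bit′ v with v F.≟ x
      ... | yes refl = ≤-reflexive (set-same q v 1)
      ... | no v≢x   = ≤-trans (≤-reflexive (set-other q 1 v≢x)) (bit v)
      selected′ : ∀ v → set q x 1 ! v ≢ 0 → c < σ ! v
      selected′ v v≢0 with v F.≟ x
      ... | yes refl = ≤-reflexive (sym x≡)
      ... | no v≢x   = <⇒≤ (selected v (old v≢x v≢0))
      independent′ : ∀ u v → set q x 1 ! u ≢ 0 → set q x 1 ! v ≢ 0 → ¬ D ⟨ u ⟶ v ⟩
      independent′ u v u≢0 v≢0 edge with u F.≟ x | v F.≟ x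
      ... | yes refl | yes refl = loopless D u edge
      ... | no u≢x   | no v≢x   = independent u v (old u≢x u≢0) (old v≢x v≢0) edge
      ... | no u≢x   | yes refl = ¬dom (u , old u≢x u≢0 , edge)
      ... | yes refl | no v≢x   = <-asym (selected v (old v≢x v≢0))
              (subst (σ ! v <_) x≡ (st .backward u v σx≢0 (λ z → contradiction (subst (suc c <_) z (selected v (old v≢x v≢0))) λ ()) edge))
      le : q ⊑ set q x 1
      le .keeps v v≢0 = set-other q {x} 1 λ { refl → <-irrefl (sym x≡) (selected v v≢0) }
      absorbed′ : ∀ v → c < σ ! v → set q x 1 ! v ≢ 0 ⊎ Dominated (set q x 1) v
      absorbed′ v c<v with v F.≟ x
      ... | yes refl = inj₁ λ z → contradiction (trans (sym z) (set-same q v 1)) λ ()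
      -- `x` is the only vertex with stamp `suc c`, so `v` was decided earlier.
      ... | no v≢x with absorbed v (≤∧≢⇒< c<v λ same → v≢x (sym (st .distinct x v σx≢0 (trans x≡ same))))
      ...   | inj₁ v≢0 = inj₁ (v≢0 ∘ ⊑-free le v)
      ...   | inj₂ dom = inj₂ (Dominated-mono le dom)

    peeling-skip : (∀ v → σ ! v ≡ suc c → Dominated q v) → Peeling σ c q
    peeling-skip why-not = record
      { bit         = bit
      ; selected    = λ v v≢0 → <⇒≤ (selected v v≢0)
      ; independent = independent
      ; absorbed    = absorbed′
      }
      where
      absorbed′ : ∀ v → c < σ ! v → q ! v ≢ 0 ⊎ Dominated q v
      absorbed′ v c<v with m≤n⇒m<n∨m≡n c<v
      ... | inj₁ c+1<v = absorbed v c+1<v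
      ... | inj₂ c+1≡v = inj₂ (why-not v (sym c+1≡v))

-- Counting

-- Double counting: the vertices satisfying `P` are grouped by their image under `τ`. It is applied
-- to leaves with `f` and to roots with `target`.
fibre : ∀ {n} {P : Fin n → Set} (P? : ∀ u → Dec (P u)) (τ : Fin n → Fin n) (h : Fin n → ℕ) →
  sum (λ p → sum (λ u → 𝟙 (P? u ×-dec (τ u F.≟ p))) * h p) ≡ sum λ u → 𝟙 (P? u) * h (τ u)
fibre {n} P? τ h = begin
  sum (λ p → sum (λ u → at u p) * h p)    ≡⟨ sum-cong-≗ (λ p → trans (*-comm _ (h p)) (sym (sum-scale (h p) (λ u → at u p)))) ⟩
  sum (λ p → sum (λ u → h p * at u p))    ≡⟨ ∑-comm (λ p u → h p * at u p) ⟩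
  sum (λ u → sum (λ p → h p * at u p))    ≡⟨ sum-cong-≗ (λ u → sum-single (λ p → h p * at u p) (τ u) λ p p≢ →
                                               trans (cong (h p *_) (𝟙-no (P? u ×-dec (τ u F.≟ p)) λ { (_ , τu≡p) → p≢ (sym τu≡p) })) (*-zeroʳ (h p))) ⟩
  sum (λ u → h (τ u) * at u (τ u))        ≡⟨ sum-cong-≗ (λ u → trans (*-comm (h (τ u)) _) (cong (_* h (τ u))
                                               (𝟙-cong (P? u ×-dec (τ u F.≟ τ u)) (P? u) proj₁ (_, refl)))) ⟩
  sum (λ u → 𝟙 (P? u) * h (τ u))          ∎
  where
  open ≡-Reasoning
  at : Fin n → Fin n → ℕ
  at u p = 𝟙 (P? u ×-dec (τ u F.≟ p))

4*m*n≤[m+n]² : ∀ m n → 4 * (m * n) ≤ (m + n) ^ 2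
4*m*n≤[m+n]² m n with ≤-total m n
... | inj₁ m≤n with k , refl ← m≤n⇒∃[o]m+o≡n m≤n =
  m+n≤o⇒m≤o _ {k * k} (≤-reflexive (square m k))
  where
  open +-*-Solver
  square : ∀ m k → 4 * (m * (m + k)) + k * k ≡ (m + (m + k)) ^ 2
  square = solve 2 (λ m k → con 4 :* (m :* (m :+ k)) :+ k :* k := (m :+ (m :+ k)) :^ 2) refl
... | inj₂ n≤m with k , refl ← m≤n⇒∃[o]m+o≡n n≤m =
  m+n≤o⇒m≤o _ {k * k} (≤-reflexive (square n k))
  where
  open +-*-Solver
  square : ∀ n k → 4 * ((n + k) * n) + k * k ≡ (n + k + n) ^ 2
  square = solve 2 (λ n k → con 4 :* ((n :+ k) :* n) :+ k :* k := (n :+ k :+ n) :^ 2) refl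

-- With s = g + l - 1 the difference of the two sides is at least (d - s) (d s - 4).
target-bound-large : ∀ s e g l → g + l ≡ 3 + s → let d = 2 + s + e in
  4 * d * (g * suc l) + (d + 2) ^ 2 ≤ (d + 2) ^ 2 * (g + l)
target-bound-large s e g l g+l≡ = begin
  4 * d * (g * suc l) + W        ≡⟨ cong (_+ W) (swap d (g * suc l)) ⟩
  d * (4 * (g * suc l)) + W      ≤⟨ +-monoˡ-≤ W (*-monoʳ-≤ d (4*m*n≤[m+n]² g (suc l))) ⟩
  d * (g + suc l) ^ 2 + W        ≡⟨ cong (λ t → d * t ^ 2 + W) (trans (+-suc g l) (cong suc g+l≡)) ⟩
  d * (4 + s) ^ 2 + W            ≤⟨ m+n≤o⇒m≤o _ (≤-reflexive (difference s e)) ⟩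
  W * (3 + s)                    ≡⟨ cong (W *_) (sym g+l≡) ⟩
  W * (g + l)                    ∎
  where
  open ≤-Reasoning
  open +-*-Solver
  d = 2 + s + e
  W = (d + 2) ^ 2
  swap : ∀ d x → 4 * d * x ≡ d * (4 * x)
  swap = solve 2 (λ d x → con 4 :* d :* x := d :* (con 4 :* x)) refl
  -- In this lemma `s` starts at g + l = 3, so g + l - 1 is `2 + s` and `e` is what d exceeds it by.
  -- The cofactor of `e` is d (2 + s) - 4, multiplied out.
  difference : ∀ s e → (2 + s + e) * (4 + s) ^ 2 + (2 + s + e + 2) ^ 2 + e * (4 * s + s * s + 2 * e + e * s)
    ≡ (2 + s + e + 2) ^ 2 * (3 + s)
  difference = solve 2 (λ s e →
    (con 2 :+ s :+ e) :* (con 4 :+ s) :^ 2 :+ (con 2 :+ s :+ e :+ con 2) :^ 2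
      :+ e :* (con 4 :* s :+ s :* s :+ con 2 :* e :+ e :* s)
    := (con 2 :+ s :+ e :+ con 2) :^ 2 :* (con 3 :+ s)) refl

4*m≤[m+2]² : ∀ d → 4 * d ≤ (d + 2) ^ 2
4*m≤[m+2]² d = m+n≤o⇒m≤o _ (≤-reflexive (square d))
  where
  open +-*-Solver
  square : ∀ d → 4 * d + (d * d + 4) ≡ (d + 2) ^ 2
  square = solve 1 (λ d → con 4 :* d :+ (d :* d :+ con 4) := (d :+ con 2) :^ 2) refl

-- The estimate by AM-GM needs d (g + l - 1) ≥ 4, which follows from g + l ≥ 3. The remaining case g
-- = l = 1 amounts to 8 d ≤ (d + 2)², with difference (d - 2)².
target-bound : ∀ d g l → 2 ≤ d → 1 ≤ g → 1 ≤ l → g + l ≤ suc d →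
  4 * d * (g * suc l) + (d + 2) ^ 2 ≤ (d + 2) ^ 2 * (g + l)
target-bound d 1 1 2≤d _ _ _ with k , refl ← m≤n⇒∃[o]m+o≡n 2≤d = m+n≤o⇒m≤o _ (≤-reflexive (square k))
  where
  open +-*-Solver
  square : ∀ k → 4 * (2 + k) * (1 * 2) + (2 + k + 2) ^ 2 + k * k ≡ (2 + k + 2) ^ 2 * 2
  square = solve 1 (λ k → con 4 :* (con 2 :+ k) :* (con 1 :* con 2) :+ (con 2 :+ k :+ con 2) :^ 2 :+ k :* k
                      := (con 2 :+ k :+ con 2) :^ 2 :* con 2) refl
target-bound d 1 (suc (suc b)) _ _ _ g+l≤ with e , refl ← m≤n⇒∃[o]m+o≡n (s≤s⁻¹ g+l≤) =
  target-bound-large b e 1 (2 + b) refl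
target-bound d (suc (suc a)) (suc b) _ _ _ g+l≤
  with e , refl ← m≤n⇒∃[o]m+o≡n (subst (_≤ d) (cong suc (+-suc a b)) (s≤s⁻¹ g+l≤)) =
  target-bound-large (a + b) e (2 + a) (suc b) (cong (2 +_) (+-suc a b))

module Counting {n : ℕ} (D : Digraph n) (f : Fin n → Fin n) (f-edge : ∀ v → D ⟨ f v ⟶ v ⟩)
  (d : ℕ) (2≤d : 2 ≤ d) (outdegree≤d : ∀ v → outdegree D v ≤ d)
  (κ : Row) (consistent : Stars.Consistent D f f-edge κ) (allColoured : ∀ (v : Fin n) → κ ! v ≢ 0)
  (T : Fin n → Set) (T? : ∀ v → Dec (T v)) (T-rich : ∀ t → T t → 1 ≤ Invariants.leaves D f f-edge κ t)
  (Q : Subset n) (independent : Independent D Q) (avoids : ∀ t u → T t → ¬ T u → D ⟨ t ⟶ u ⟩ → u ∉ Q)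
  (excuse : ∀ u → κ ! u ≡ 2 → ¬ T u →
    (∃[ t ] T t × D ⟨ t ⟶ u ⟩ × Invariants.leaves D f f-edge κ u ≤ Invariants.leaves D f f-edge κ t)
    ⊎ (Invariants.leaves D f f-edge κ u ≡ 0 × (∃[ a ] T a × f a ≡ u)))
  where
  open Invariants D f f-edge

  private
    W = (d + 2) ^ 2
    L = leaves κ

    root? : ∀ (v : Fin n) → Dec (κ ! v ≡ 2)
    root? v = κ ! v ≟ 2
    leaf? : ∀ (v : Fin n) → Dec (κ ! v ≡ 1)
    leaf? v = κ ! v ≟ 1

  data Role (u : Fin n) : Set where
    notRoot : κ ! u ≡ 1 → Role u
    centre  : κ ! u ≡ 2 → T u → Role u
    guarded : κ ! u ≡ 2 → ¬ T u → ∀ t → T t → D ⟨ t ⟶ u ⟩ → L u ≤ L t → Role u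
    orphan  : κ ! u ≡ 2 → ¬ T u → L u ≡ 0 → ∀ a → T a → f a ≡ u → Role u

  role : ∀ u → Role u
  role u with colourOf consistent u
  ... | isFree z = ⊥-elim (allColoured u z)
  ... | isLeaf l = notRoot l
  ... | isRoot r with T? u
  ...   | yes Tu = centre r Tu
  ...   | no ¬Tu with excuse u r ¬Tu
  ...     | inj₁ (t , Tt , edge , L≤) = guarded r ¬Tu t Tt edge L≤
  ...     | inj₂ (L≡0 , a , Ta , fa)  = orphan r ¬Tu L≡0 a Ta fa

  -- The vertex to which the root u and its leaves are charged.
  target : Fin n → Fin n
  target u with role u
  ... | guarded _ _ t _ _ _ = t
  ... | _                   = u

  target-leaves : ∀ u → κ ! u ≡ 2 → L u ≤ L (target u)
  target-leaves u r with role u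
  ... | notRoot _             = ≤-refl
  ... | centre _ _            = ≤-refl
  ... | guarded _ _ t _ _ Lu≤ = Lu≤
  ... | orphan _ _ _ _ _ _    = ≤-refl

  T-root : ∀ t → T t → κ ! t ≡ 2
  T-root t Tt = HasLeaf-root consistent (leaves⇒HasLeaf κ t (T-rich t Tt))

  target-centre : ∀ t → T t → target t ≡ t
  target-centre t Tt with role t
  ... | notRoot _             = refl
  ... | centre _ _            = refl
  ... | guarded _ ¬Tt _ _ _ _ = ⊥-elim (¬Tt Tt)
  ... | orphan _ _ _ _ _ _    = refl

  target-edge : ∀ u p → target u ≡ p → u ≡ p ⊎ D ⟨ p ⟶ u ⟩
  target-edge u p τu with role u
  ... | notRoot _               = inj₁ τu
  ... | centre _ _              = inj₁ τu
  ... | guarded _ _ t _ edge _  = inj₂ (subst (λ t → D ⟨ t ⟶ u ⟩) τu edge)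
  ... | orphan _ _ _ _ _ _      = inj₁ τu

  -- A charge falls outside `T` only when an orphan is charged to itself, and orphans are leafless.
  target-outside : ∀ u p → κ ! u ≡ 2 → target u ≡ p → ¬ T p → L p ≡ 0
  target-outside u p r τu ¬Tp with role u
  ... | notRoot l             = contradiction (trans (sym l) r) λ ()
  ... | centre _ Tu           = ⊥-elim (¬Tp (subst T τu Tu))
  ... | guarded _ _ t Tt _ _  = ⊥-elim (¬Tp (subst T τu Tt))
  ... | orphan _ _ L≡0 _ _ _  = trans (cong L (sym τu)) L≡0

  targeted? : ∀ p u → Dec (κ ! u ≡ 2 × target u ≡ p)
  targeted? p u = root? u ×-dec (target u F.≟ p)

  g : Fin n → ℕ
  g p = sum λ u → 𝟙 (targeted? p u)

  -- Leaves are counted at their parents, so the stars exhaust the vertices. Each star is then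
  -- enlarged to the size of the star of its target, which makes all charges to `p` equal to
  -- `suc (L p)`.
  order≤targets : n ≤ sum λ p → g p * suc (L p)
  order≤targets = begin
    n                                                    ≡⟨ sym (sum-one n) ⟩
    sum {n} (λ _ → 1)                                    ≤⟨ sum-mono {n} (λ _ → 1) (λ v → 𝟙 (root? v) + 𝟙 (leaf? v) * 1) colours ⟩
    sum (λ v → 𝟙 (root? v) + 𝟙 (leaf? v) * 1)            ≡⟨ ∑-distrib-+ (λ v → 𝟙 (root? v)) (λ v → 𝟙 (leaf? v) * 1) ⟩
    sum (λ v → 𝟙 (root? v)) + sum (λ v → 𝟙 (leaf? v) * 1) ≡⟨ cong (sum (λ v → 𝟙 (root? v)) +_) (sym (fibre leaf? f (λ _ → 1))) ⟩
    sum (λ v → 𝟙 (root? v)) + sum (λ p → L p * 1)        ≡⟨ sym (∑-distrib-+ (λ v → 𝟙 (root? v)) (λ p → L p * 1)) ⟩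
    sum (λ v → 𝟙 (root? v) + L v * 1)                    ≤⟨ sum-mono (λ v → 𝟙 (root? v) + L v * 1) (λ v → 𝟙 (root? v) * suc (L (target v))) stars ⟩
    sum (λ v → 𝟙 (root? v) * suc (L (target v)))         ≡⟨ sym (fibre root? target (λ p → suc (L p))) ⟩
    sum (λ p → g p * suc (L p))                          ∎
    where
    open ≤-Reasoning
    colours : ∀ v → 1 ≤ 𝟙 (root? v) + 𝟙 (leaf? v) * 1
    colours v with colourOf consistent v
    ... | isFree z = ⊥-elim (allColoured v z)
    ... | isLeaf l rewrite 𝟙-yes (leaf? v) l = m≤n+m 1 (𝟙 (root? v))
    ... | isRoot r rewrite 𝟙-yes (root? v) r = m≤m+n 1 _
    stars : ∀ v → 𝟙 (root? v) + L v * 1 ≤ 𝟙 (root? v) * suc (L (target v))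
    stars v with root? v
    ... | yes r = s≤s (≤-trans (≤-reflexive (*-identityʳ (L v))) (≤-trans (target-leaves v r) (m≤m+n _ 0)))
    ... | no ¬r with L v in Lv
    ...   | zero  = z≤n
    ...   | suc l = ⊥-elim (¬r (HasLeaf-root consistent (leaves⇒HasLeaf κ v (subst (1 ≤_) (sym Lv) z<s))))

  T-targeted : ∀ t → T t → 1 ≤ g t
  T-targeted t Tt = ≤-trans (≤-reflexive (sym (𝟙-yes (targeted? t t) (T-root t Tt , target-centre t Tt))))
                      (term≤sum (λ u → 𝟙 (targeted? t u)) t)

  -- Except for `t` itself, everything counted is an out-neighbour of `t`, and the colour keeps
  -- roots and leaves disjoint.
  T-degree : ∀ t → g t + L t ≤ suc d
  T-degree t = begin
    g t + L t                                              ≡⟨ sym (∑-distrib-+ (λ u → 𝟙 (targeted? t u)) (λ u → 𝟙 (leafOf? κ t u))) ⟩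
    sum (λ u → 𝟙 (targeted? t u) + 𝟙 (leafOf? κ t u))      ≤⟨ sum-mono _ (λ u → 𝟙 (u F.≟ t) + 𝟙 (u ∈? N⁺ D t)) near ⟩
    sum (λ u → 𝟙 (u F.≟ t) + 𝟙 (u ∈? N⁺ D t))              ≡⟨ ∑-distrib-+ (λ u → 𝟙 (u F.≟ t)) (λ u → 𝟙 (u ∈? N⁺ D t)) ⟩
    sum (λ u → 𝟙 (u F.≟ t)) + sum (λ u → 𝟙 (u ∈? N⁺ D t))  ≡⟨ cong₂ _+_ (trans (sum-single (λ u → 𝟙 (u F.≟ t)) t (λ u → 𝟙-no (u F.≟ t))) (𝟙-yes (t F.≟ t) refl)) (sym (card (N⁺ D t))) ⟩
    suc (outdegree D t)                                    ≤⟨ s≤s (outdegree≤d t) ⟩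
    suc d                                                  ∎
    where
    open ≤-Reasoning
    near : ∀ u → 𝟙 (targeted? t u) + 𝟙 (leafOf? κ t u) ≤ 𝟙 (u F.≟ t) + 𝟙 (u ∈? N⁺ D t)
    near u with targeted? t u | leafOf? κ t u
    ... | yes (r , _)  | yes (l , _) = contradiction (trans (sym r) l) λ ()
    ... | no _ | no _ = z≤n
    ... | no _ | yes (_ , refl) = ≤-trans (≤-reflexive (sym (𝟙-yes (u ∈? N⁺ D (f u)) (f-edge u)))) (m≤n+m _ (𝟙 (u F.≟ f u)))
    ... | yes (_ , τu) | no _ with target-edge u t τu
    ...   | inj₁ u≡t = ≤-trans (≤-reflexive (sym (𝟙-yes (u F.≟ t) u≡t))) (m≤m+n _ _)
    ...   | inj₂ edge = ≤-trans (≤-reflexive (sym (𝟙-yes (u ∈? N⁺ D t) edge))) (m≤n+m _ (𝟙 (u F.≟ t)))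

  -- `W * 𝟙 (T? p)` is the -1 of the credit g - 1 + l, moved to the other side. Outside `T` only
  -- leafless orphans carry a charge, and 4 d ≤ (d + 2)² is enough.
  per-target : ∀ p → 4 * d * (g p * suc (L p)) + W * 𝟙 (T? p) ≤ W * (g p + L p * 𝟙 (T? p))
  per-target p with T? p
  ... | yes Tp = subst₂ _≤_ (cong (4 * d * (g p * suc (L p)) +_) (sym (*-identityʳ W)))
                   (cong (λ l → W * (g p + l)) (sym (*-identityʳ (L p))))
                   (target-bound d (g p) (L p) 2≤d (T-targeted p Tp) (T-rich p Tp) (T-degree p))
  ... | no ¬Tp with any? (targeted? p)
  ...   | no none rewrite sum-zero (λ u → 𝟙 (targeted? p u)) (λ u → 𝟙-no (targeted? p u) λ tg → none (u , tg))
                        | *-zeroʳ (4 * d) | *-zeroʳ W = z≤n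
  ...   | yes (u , r , τu) rewrite target-outside u p r τu ¬Tp = begin
          4 * d * (g p * 1) + W * 0   ≡⟨ cong₂ _+_ (cong (4 * d *_) (*-identityʳ (g p))) (*-zeroʳ W) ⟩
          4 * d * g p + 0             ≡⟨ +-identityʳ _ ⟩
          4 * d * g p                 ≤⟨ *-monoˡ-≤ (g p) (4*m≤[m+2]² d) ⟩
          W * g p                     ≡⟨ cong (W *_) (sym (+-identityʳ (g p))) ⟩
          W * (g p + 0)               ∎
    where open ≤-Reasoning

  outside? : ∀ v → Dec (v ∉ Q)
  outside? v = ¬? (v ∈? Q)

  exchanged? : ∀ u → Dec (κ ! u ≡ 2 × ¬ T u × u ∈ Q)
  exchanged? u = root? u ×-dec (¬? (T? u) ×-dec (u ∈? Q))

  dropped? : ∀ a → Dec (T a × a ∉ Q)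
  dropped? a = T? a ×-dec outside? a

  -- An orphan f a in Q excludes a, which lies in T, from Q.
  exchange : sum (λ u → 𝟙 (exchanged? u)) ≤ sum (λ a → 𝟙 (dropped? a))
  exchange = begin
    sum (λ u → 𝟙 (exchanged? u))                                         ≤⟨ sum-mono (λ u → 𝟙 (exchanged? u)) _ injection ⟩
    sum (λ p → sum (λ a → 𝟙 (dropped? a ×-dec (f a F.≟ p))) * 1)         ≡⟨ fibre dropped? f (λ _ → 1) ⟩
    sum (λ a → 𝟙 (dropped? a) * 1)                                       ≡⟨ sum-cong-≗ (λ a → *-identityʳ (𝟙 (dropped? a))) ⟩
    sum (λ a → 𝟙 (dropped? a))                                           ∎
    where
    open ≤-Reasoning
    injection : ∀ p → 𝟙 (exchanged? p) ≤ sum (λ a → 𝟙 (dropped? a ×-dec (f a F.≟ p))) * 1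
    injection p with exchanged? p
    ... | no _ = z≤n
    ... | yes (r , ¬Tp , p∈Q) with excuse p r ¬Tp
    ...   | inj₁ (t , Tt , edge , _) = ⊥-elim (avoids t p Tt ¬Tp edge p∈Q)
    ...   | inj₂ (_ , a , Ta , fa)   = ≤-trans
            (≤-reflexive (sym (𝟙-yes (dropped? a ×-dec (f a F.≟ p)) ((Ta , a∉Q) , fa))))
            (≤-trans (term≤sum (λ a → 𝟙 (dropped? a ×-dec (f a F.≟ p))) a) (≤-reflexive (sym (*-identityʳ _))))
      where
      a∉Q : a ∉ Q
      a∉Q a∈Q = independent p a p∈Q a∈Q (subst (λ u → D ⟨ u ⟶ a ⟩) fa (f-edge a))

  -- The credit is verified vertex by vertex. An orphan inside `Q` is not missing from `Q`, so it
  -- borrows the term `exchanged?`; summed up, the loan is repaid by `dropped?`, the members of `T`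
  -- absent from `Q`.
  lost : ∀ v → (𝟙 (root? v) + 𝟙 (leaf? v) * 𝟙 (T? (f v))) + 𝟙 (dropped? v)
             ≤ (𝟙 (outside? v) + 𝟙 (T? v)) + 𝟙 (exchanged? v)
  lost v with role v
  ... | notRoot l rewrite 𝟙-yes (leaf? v) l | 𝟙-no (root? v) (λ r → contradiction (trans (sym l) r) λ ())
                        | 𝟙-no (dropped? v) (λ { (Tv , _) → contradiction (trans (sym l) (T-root v Tv)) λ () })
        = ≤-trans (≤-reflexive (trans (+-identityʳ _) (+-identityʳ _))) (≤-trans
            (𝟙-mono (T? (f v)) (outside? v) λ Tf → avoids (f v) v Tf (λ Tv → contradiction (trans (sym l) (T-root v Tv)) λ ()) (f-edge v))
            (≤-trans (m≤m+n _ (𝟙 (T? v))) (m≤m+n _ (𝟙 (exchanged? v)))))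
  ... | centre r Tv rewrite 𝟙-yes (root? v) r | 𝟙-no (leaf? v) (λ l → contradiction (trans (sym l) r) λ ())
                          | 𝟙-yes (T? v) Tv
        = ≤-trans (s≤s (𝟙-mono (dropped? v) (outside? v) proj₂))
            (≤-trans (≤-reflexive (+-comm 1 _)) (m≤m+n _ (𝟙 (exchanged? v))))
  ... | guarded r ¬Tv t Tt edge _
        rewrite 𝟙-yes (root? v) r | 𝟙-no (leaf? v) (λ l → contradiction (trans (sym l) r) λ ())
              | 𝟙-no (dropped? v) (λ { (Tv , _) → ¬Tv Tv }) | 𝟙-yes (outside? v) (avoids t v Tt ¬Tv edge)
        = s≤s z≤n
  ... | orphan r ¬Tv _ _ _ _
        rewrite 𝟙-yes (root? v) r | 𝟙-no (leaf? v) (λ l → contradiction (trans (sym l) r) λ ())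
              | 𝟙-no (dropped? v) (λ { (Tv , _) → ¬Tv Tv })
        with v ∈? Q
  ...   | yes v∈Q rewrite 𝟙-yes (root? v ×-dec (¬? (T? v) ×-dec yes v∈Q)) (r , ¬Tv , v∈Q) = m≤n+m 1 _
  ...   | no  _   = s≤s z≤n

  private
    #outside = sum λ v → 𝟙 (outside? v)
    #T       = sum λ v → 𝟙 (T? v)
    #root    = sum λ v → 𝟙 (root? v)
    #served  = sum λ v → 𝟙 (leaf? v) * 𝟙 (T? (f v))
    #dropped = sum λ v → 𝟙 (dropped? v)

  root+served≤ : #root + #served ≤ #outside + #T
  root+served≤ = +-cancelʳ-≤ #dropped _ _ (begin
    #root + #served + #dropped
      ≡⟨ cong (_+ #dropped) (sym (∑-distrib-+ (λ v → 𝟙 (root? v)) (λ v → 𝟙 (leaf? v) * 𝟙 (T? (f v))))) ⟩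
    sum (λ v → 𝟙 (root? v) + 𝟙 (leaf? v) * 𝟙 (T? (f v))) + #dropped
      ≡⟨ sym (∑-distrib-+ (λ v → 𝟙 (root? v) + 𝟙 (leaf? v) * 𝟙 (T? (f v))) (λ v → 𝟙 (dropped? v))) ⟩
    sum (λ v → (𝟙 (root? v) + 𝟙 (leaf? v) * 𝟙 (T? (f v))) + 𝟙 (dropped? v))
      ≤⟨ sum-mono _ (λ v → (𝟙 (outside? v) + 𝟙 (T? v)) + 𝟙 (exchanged? v)) lost ⟩
    sum (λ v → (𝟙 (outside? v) + 𝟙 (T? v)) + 𝟙 (exchanged? v))
      ≡⟨ ∑-distrib-+ (λ v → 𝟙 (outside? v) + 𝟙 (T? v)) (λ v → 𝟙 (exchanged? v)) ⟩
    sum (λ v → 𝟙 (outside? v) + 𝟙 (T? v)) + sum (λ v → 𝟙 (exchanged? v))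
      ≡⟨ cong (_+ sum (λ v → 𝟙 (exchanged? v))) (∑-distrib-+ (λ v → 𝟙 (outside? v)) (λ v → 𝟙 (T? v))) ⟩
    #outside + #T + sum (λ v → 𝟙 (exchanged? v))
      ≤⟨ +-monoʳ-≤ (#outside + #T) exchange ⟩
    #outside + #T + #dropped ∎)
    where open ≤-Reasoning

  many-outside : 4 * d * n ≤ W * #outside
  many-outside = +-cancelʳ-≤ (W * #T) _ _ (begin
    4 * d * n + W * #T
      ≤⟨ +-monoˡ-≤ (W * #T) (*-monoʳ-≤ (4 * d) order≤targets) ⟩
    4 * d * sum (λ p → g p * suc (L p)) + W * #T
      ≡⟨ sym (cong₂ _+_ (sum-scale (4 * d) (λ p → g p * suc (L p))) (sum-scale W (λ p → 𝟙 (T? p)))) ⟩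
    sum (λ p → 4 * d * (g p * suc (L p))) + sum (λ p → W * 𝟙 (T? p))
      ≡⟨ sym (∑-distrib-+ (λ p → 4 * d * (g p * suc (L p))) (λ p → W * 𝟙 (T? p))) ⟩
    sum (λ p → 4 * d * (g p * suc (L p)) + W * 𝟙 (T? p))
      ≤⟨ sum-mono _ (λ p → W * (g p + L p * 𝟙 (T? p))) per-target ⟩
    sum (λ p → W * (g p + L p * 𝟙 (T? p)))
      ≡⟨ sum-scale W (λ p → g p + L p * 𝟙 (T? p)) ⟩
    W * sum (λ p → g p + L p * 𝟙 (T? p))
      ≡⟨ cong (W *_) (trans (∑-distrib-+ g (λ p → L p * 𝟙 (T? p))) (cong₂ _+_ roots (fibre leaf? f (λ p → 𝟙 (T? p))))) ⟩
    W * (#root + #served)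
      ≤⟨ *-monoʳ-≤ W root+served≤ ⟩
    W * (#outside + #T)
      ≡⟨ *-distribˡ-+ W #outside #T ⟩
    W * #outside + W * #T ∎)
    where
    open ≤-Reasoning
    roots : sum g ≡ #root
    roots = trans (sum-cong-≗ (λ p → sym (*-identityʳ (g p))))
      (trans (fibre root? target (λ _ → 1)) (sum-cong-≗ (λ u → *-identityʳ (𝟙 (root? u)))))

  -- The numerator arises as (d + 2)² - 4 d = d² + 4.
  small : ∣ Q ∣ * (d + 2) ^ 2 ≤ (d ^ 2 + 4) * n
  small = +-cancelʳ-≤ (4 * d * n) _ _ (begin
    ∣ Q ∣ * W + 4 * d * n       ≤⟨ +-monoʳ-≤ (∣ Q ∣ * W) many-outside ⟩
    ∣ Q ∣ * W + W * #outside    ≡⟨ cong₂ _+_ (*-comm ∣ Q ∣ W) refl ⟩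
    W * ∣ Q ∣ + W * #outside    ≡⟨ sym (*-distribˡ-+ W ∣ Q ∣ #outside) ⟩
    W * (∣ Q ∣ + #outside)      ≡⟨ cong (W *_) total ⟩
    W * n                       ≡⟨ expand d n ⟩
    (d ^ 2 + 4) * n + 4 * d * n ∎)
    where
    open ≤-Reasoning
    open +-*-Solver
    expand : ∀ d n → (d + 2) ^ 2 * n ≡ (d ^ 2 + 4) * n + 4 * d * n
    expand = solve 2 (λ d n → (d :+ con 2) :^ 2 :* n := (d :^ 2 :+ con 4) :* n :+ con 4 :* d :* n) refl
    either : ∀ v → 𝟙 (v ∈? Q) + 𝟙 (outside? v) ≡ 1
    either v with v ∈? Q
    ... | yes _ = refl
    ... | no  _ = refl
    total : ∣ Q ∣ + #outside ≡ n
    total = trans (cong (_+ #outside) (card Q)) (trans (sym (∑-distrib-+ (λ v → 𝟙 (v ∈? Q)) (λ v → 𝟙 (outside? v))))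
      (trans (sum-cong-≗ either) (sum-one n)))

-- The algorithm

-- `selectedA` has to be 0, the array that `output` reads. The arrays from `countA` on are used at
-- index 0 only, as variables, because the registers are reserved for loop counters.
selectedA colourA stampA markA countA flagA startA walkA clockA curA : ℕ
selectedA = 0
colourA   = 1
stampA    = 2
markA     = 3
countA    = 4
flagA     = 5
startA    = 6
walkA     = 7
clockA    = 8
curA      = 9

cell : ℕ → Expr
cell a = read a (lit 0)

assign! : ∀ {k} → ℕ → Expr → Prog k
assign! a e = put a (lit 0) e

parent : Expr → Expr
parent e = nbr inward e (lit 0)

tick : ∀ {k} → Prog k
tick = assign! clockA (succ (cell clockA))

countTest : ℕ → Test
countTest a = (read colourA (var 0) eq lit 1) and (parent (var 0) eq cell a)

countStep : ℕ → Prog 0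
countStep a = when (countTest a) (assign! countA (succ (cell countA)))

countLeaves : ℕ → Prog 1
countLeaves a = assign! countA (lit 0) ▹ for (countStep a)

seekTest : ℕ → Test
seekTest a = neg (read a (var 0) eq lit 0) and member outward (cell curA) (var 0)

seekStep : ℕ → Prog 0
seekStep a = when (seekTest a) (assign! flagA (lit 1))

seek : ℕ → Prog 1
seek a = assign! flagA (lit 0) ▹ for (seekStep a)

settle! : Prog 0
settle! = put colourA (var 0) (lit 1) ▹ put colourA (parent (var 0)) (lit 2)

freeTest unmarkedTest : Test
freeTest     = read colourA (var 0) eq lit 0
unmarkedTest = freeTest and (read markA (var 0) eq lit 0)

clearMark markParent settleUnmarked : Prog 0
clearMark      = put markA (var 0) (lit 0)
markParent     = when freeTest (put markA (parent (var 0)) (lit 1))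
settleUnmarked = when unmarkedTest settle!

-- Marks turn childlessness into a test of constant time, so a round is linear and `n` rounds are
-- quadratic.
stripRound : Prog 1
stripRound = for clearMark ▹ for markParent ▹ for settleUnmarked

strip : Prog 2
strip = for stripRound

select! : Prog 1
select! = put stampA (cell curA) (succ (cell clockA))

sweepTest : ℕ → Test
sweepTest k = neg (cell countA lt lit k) and ((cell flagA eq lit 0) and (read stampA (cell curA) eq lit 0))

sweepAt : ℕ → Prog 1
sweepAt k = assign! curA (var 1) ▹ countLeaves curA ▹ seek stampA ▹ when (sweepTest k) select! ▹ tick

sweep : ℕ → Prog 2
sweep k = for (sweepAt k)

-- Sweeps for k = m + 2 , … , 2.
sweeps : ℕ → Prog 2
sweeps zero    = sweep 2
sweeps (suc m) = sweep (3 + m) ▹ sweeps m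

walkTest : Test
walkTest = read colourA (parent (cell walkA)) eq lit 0

walkOn walkStep : Prog 0
walkOn = put colourA (parent (cell walkA)) (lit 1)
       ▹ assign! walkA (parent (parent (cell walkA)))
       ▹ put colourA (cell walkA) (lit 2)
walkStep = when walkTest walkOn

walk : Prog 1
walk = put colourA (cell startA) (lit 2) ▹ assign! walkA (cell startA) ▹ for walkStep

dominatedTest : Test
dominatedTest = neg (cell flagA eq lit 0)

-- The start of the walk is the vertex that may stay leafless: the current one if it is dominated,
-- otherwise its parent.
chooseStart : Prog 1
chooseStart = assign! startA (parent (cell curA)) ▹ when dominatedTest (assign! startA (cell curA))

bareTest : Test
bareTest = (cell flagA eq lit 0) and (cell countA eq lit 0)

breakCycle : Prog 1
breakCycle = seek stampA ▹ chooseStart ▹ walk ▹ countLeaves startA ▹ when bareTest select!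

curFreeTest : Test
curFreeTest = read colourA (cell curA) eq lit 0

cycleAt : Prog 1
cycleAt = assign! curA (var 1) ▹ when curFreeTest breakCycle ▹ tick

cycles : Prog 2
cycles = for cycleAt

stampTest : Test
stampTest = read stampA (var 0) eq cell clockA

findStep : Prog 0
findStep = when stampTest (assign! curA (var 0))

-- The stamp is compared again because the default choice survives the search when no vertex carries
-- the current stamp. Clock 0 is excluded because stamp 0 means "not selected".
peelTest : Test
peelTest = (read stampA (cell curA) eq cell clockA) and ((cell flagA eq lit 0) and neg (cell clockA eq lit 0))

peelAt : Prog 1
peelAt = assign! curA (var 1) ▹ for findStep ▹ seek selectedA
  ▹ when peelTest (put selectedA (cell curA) (lit 1))
  ▹ assign! clockA (cell clockA ⊖ lit 1)

peelings : ℕ → Prog 2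
peelings zero    = for peelAt
peelings (suc m) = for peelAt ▹ peelings m

-- Here `m` is d - 2. The clock ticks `n` times in each of the `suc m` first sweeps, the pass over
-- the cycles and the last two sweeps; `peelings (3 + m)` counts down through the same `4 + m`
-- passes.
algorithm : ℕ → Prog 2
algorithm m = strip ▹ sweeps m ▹ cycles ▹ sweep 1 ▹ sweep 0 ▹ peelings (3 + m)

-- Specifications of counting, seeking, stripping and sweeping

module Specs {n : ℕ} (D : Digraph n) (f : Fin n → Fin n) (f-edge : ∀ v → D ⟨ f v ⟶ v ⟩)
  (f-first : ∀ v → nth (map toℕ (elements (N⁻ D v))) 0 ≡ toℕ (f v)) where
  open Selection D f f-edge

  Arr : Set
  Arr = ℕ → ℕ → ℕ

  parent-value : ∀ e s v → ⟦ e ⟧ D s ≡ toℕ v → ⟦ parent e ⟧ D s ≡ toℕ (f v)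
  parent-value e s v e≡ rewrite e≡ = trans (atVertex-toℕ D 0 (λ x → nth (map toℕ (elements (N⁻ D x))) 0) v) (f-first v)

  leavesBelow : Row → Fin n → ℕ → ℕ
  leavesBelow κ u i = sum λ w → 𝟙 (toℕ w <? i) * 𝟙 (leafOf? κ u w)

  leavesBelow-all : ∀ κ u → leavesBelow κ u n ≡ leaves κ u
  leavesBelow-all κ u = sum-cong-≗ λ w →
    trans (cong (_* 𝟙 (leafOf? κ u w)) (𝟙-yes (toℕ w <? n) (toℕ<n w))) (*-identityˡ _)

  countLeaves-spec : ∀ a → a ≢ countA → ∀ s u → arr s a 0 ≡ toℕ u →
    arr (run D (countLeaves a) s) countA 0 ≡ leaves (arr s colourA) u
  countLeaves-spec a a≢ s u au = trans (for-rule D (countStep a) I step start start-holds .proj₂ .proj₂) (leavesBelow-all κ u)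
    where
    κ = arr s colourA
    start = run D {0} (assign! countA (lit 0)) s
    I : ℕ → Arr → Set
    I i A = A colourA ≡ κ × A a 0 ≡ toℕ u × A countA 0 ≡ leavesBelow κ u i
    off : ∀ (A : Arr) r → update A countA r a ≡ A a
    off A r = update-other A r (a≢ ∘ sym)
    start-holds : I 0 (arr start)
    start-holds = refl , trans (cong (λ r → r 0) (off (arr s) _)) au
                , sym (sum-zero _ λ w → cong (_* 𝟙 (leafOf? κ u w)) (𝟙-no (toℕ w <? 0) λ ()))
    step : ∀ v s → reg s 0 ≡ toℕ v → I (toℕ v) (arr s) → I (suc (toℕ v)) (arr (run D (countStep a) s))
    step v s v≡ (κ≡ , au , c≡) = when-rule D (countTest a) (assign! countA (succ (cell countA))) s (I (suc (toℕ v)))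
      (λ { (leafv , fv) → κ≡ , trans (cong (λ r → r 0) (off (arr s) _)) au
         , trans (cong suc c≡) (sym (trans (sum-below (λ w → 𝟙 (leafOf? κ u w)) v) (cong (_+ leavesBelow κ u (toℕ v))
             (𝟙-yes (leafOf? κ u v) (trans (sym here) leafv
               , toℕ-injective (trans (sym (parent-value (var 0) s v v≡)) (trans fv au))))))) })
      (λ no! → κ≡ , au , trans c≡ (sym (trans (sum-below (λ w → 𝟙 (leafOf? κ u w)) v) (cong (_+ leavesBelow κ u (toℕ v))
             (𝟙-no (leafOf? κ u v) λ { (leafv , fv) → no!
               ( trans here leafv
               , trans (parent-value (var 0) s v v≡) (trans (cong toℕ fv) (sym au))) })))))
      where
      here : arr s colourA (reg s 0) ≡ κ ! v
      here = cong₂ (λ r i → r i) κ≡ v≡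

  SeekResult : Row → Fin n → ℕ → Set
  SeekResult ρ v flag = (flag ≡ 0 → ¬ Dominated ρ v) × (flag ≢ 0 → Dominated ρ v)

  seek-spec : ∀ a → a ≢ flagA → ∀ s v → arr s curA 0 ≡ toℕ v →
    SeekResult (arr s a) v (arr (run D (seek a) s) flagA 0)
  seek-spec a a≢ s v cur = let _ , _ , none , some = for-rule D (seekStep a) I step (run D {0} (assign! flagA (lit 0)) s) start-holds
    in (λ flag (t , dom) → none flag t (toℕ<n t) dom) , some
    where
    ρ = arr s a
    I : ℕ → Arr → Set
    I i A = A a ≡ ρ × A curA 0 ≡ toℕ v
          × (A flagA 0 ≡ 0 → ∀ w → toℕ w < i → ¬ Dominates ρ w v) × (A flagA 0 ≢ 0 → Dominated ρ v)
    off : ∀ (A : Arr) r → update A flagA r a ≡ A a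
    off A r = update-other A r (a≢ ∘ sym)
    start-holds : I 0 (arr (run D {0} (assign! flagA (lit 0)) s))
    start-holds = off (arr s) _ , cur , (λ _ w ()) , λ z → ⊥-elim (z refl)
    step : ∀ w s → reg s 0 ≡ toℕ w → I (toℕ w) (arr s) → I (suc (toℕ w)) (arr (run D (seekStep a) s))
    step w s w≡ (ρ≡ , cur , none , some) = when-rule D (seekTest a) (assign! flagA (lit 1)) s (I (suc (toℕ w)))
      (λ { (w≢0 , i , j , i≡ , j≡ , edge) → trans (off (arr s) _) ρ≡ , cur , (λ ()) , λ _ → w
         , (λ z → w≢0 (trans (cong₂ (λ r i → r i) ρ≡ w≡) z))
         , subst₂ (λ i j → i ∈ N⁺ D j) (toℕ-injective (trans (sym i≡) cur)) (toℕ-injective (trans (sym j≡) w≡)) edge })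
      (λ no! → ρ≡ , cur , (λ flag x x≤w dom → below flag x x≤w dom no!) , some)
      where
      below : arr s flagA 0 ≡ 0 → ∀ x → toℕ x < suc (toℕ w) → Dominates ρ x v → ¬ ¬ Holds D (seekTest a) s
      below flag x x≤w (x≢0 , edge) no! with x F.≟ w
      ... | no x≢w   = none flag x (≤∧≢⇒< (s≤s⁻¹ x≤w) (x≢w ∘ toℕ-injective)) (x≢0 , edge)
      ... | yes refl = no! ((λ z → x≢0 (trans (sym (cong₂ (λ r i → r i) ρ≡ w≡)) z)) , v , x , cur , w≡ , edge)

  clearMarks-spec : ∀ s → ∀ (v : Fin n) → arr (run D (for clearMark) s) markA ! v ≡ 0
  clearMarks-spec s v = for-rule D clearMark I step s (λ _ ()) v (toℕ<n v)
    where
    I : ℕ → Arr → Set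
    I i A = ∀ (v : Fin n) → toℕ v < i → A markA ! v ≡ 0
    step : ∀ v s → reg s 0 ≡ toℕ v → I (toℕ v) (arr s) → I (suc (toℕ v)) (arr (run D clearMark s))
    step v s v≡ clear w w≤v rewrite v≡ with w F.≟ v
    ... | yes refl = set-same (arr s markA) w 0
    ... | no w≢v   = trans (set-other (arr s markA) 0 w≢v) (clear w (≤∧≢⇒< (s≤s⁻¹ w≤v) (w≢v ∘ toℕ-injective)))

  Marked : Row → Row → Set
  Marked κ μ = (∀ v → μ ! v ≢ 0 → FreeChild κ v) × (∀ w → κ ! w ≡ 0 → μ ! f w ≢ 0)

  markParents-spec : ∀ s → (∀ (v : Fin n) → arr s markA ! v ≡ 0) →
    Marked (arr s colourA) (arr (run D (for markParent) s) markA)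
  markParents-spec s clear = let _ , sound , complete = for-rule D markParent I step s (refl , (λ v v≢0 → ⊥-elim (v≢0 (clear v))) , λ _ ())
                             in sound , λ w → complete w (toℕ<n w)
    where
    κ = arr s colourA
    I : ℕ → Arr → Set
    I i A = A colourA ≡ κ × (∀ v → A markA ! v ≢ 0 → FreeChild κ v) × (∀ w → toℕ w < i → κ ! w ≡ 0 → A markA ! f w ≢ 0)
    step : ∀ v s → reg s 0 ≡ toℕ v → I (toℕ v) (arr s) → I (suc (toℕ v)) (arr (run D markParent s))
    step v s v≡ (κ≡ , sound , complete) = when-rule D freeTest _ s (I (suc (toℕ v)))
      (λ free → κ≡ , subst (λ j → I′ (update (arr s markA) j 1)) (sym (parent-value (var 0) s v v≡)) (marked (trans (sym here) free)))
      (λ ¬free → κ≡ , sound , λ w w≤v κw → complete w (earlier w w≤v λ { refl → ¬free (trans here κw) }) κw)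
      where
      here : arr s colourA (reg s 0) ≡ κ ! v
      here = cong₂ (λ r i → r i) κ≡ v≡
      earlier : ∀ w → toℕ w < suc (toℕ v) → w ≢ v → toℕ w < toℕ v
      earlier w w≤v w≢v = ≤∧≢⇒< (s≤s⁻¹ w≤v) (w≢v ∘ toℕ-injective)
      I′ : Row → Set
      I′ μ = (∀ v → μ ! v ≢ 0 → FreeChild κ v) × (∀ w → toℕ w < suc (toℕ v) → κ ! w ≡ 0 → μ ! f w ≢ 0)
      marked : κ ! v ≡ 0 → I′ (set (arr s markA) (f v) 1)
      marked κv .proj₁ u u≢0 with u F.≟ f v
      ... | yes refl = v , κv , refl
      ... | no u≢    = sound u (u≢0 ∘ trans (set-other (arr s markA) 1 u≢))
      marked κv .proj₂ w w≤v κw z with f w F.≟ f v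
      ... | yes same = contradiction (trans (sym (set-same (arr s markA) (f v) 1)) (trans (cong (set (arr s markA) (f v) 1 !_) (sym same)) z)) λ ()
      ... | no fw≢   = complete w (earlier w w≤v (fw≢ ∘ cong f)) κw (trans (sym (set-other (arr s markA) 1 fw≢)) z)

  settleUnmarked-spec : ∀ s κ → arr s colourA ≡ κ → Marked κ (arr s markA) → Consistent κ → RootsOf (λ _ → ⊥) κ →
    Stripping κ n (arr (run D (for settleUnmarked) s) colourA)
  settleUnmarked-spec s κ κ≡ (sound , complete) con roots = for-rule D settleUnmarked I step s (refl , start) .proj₂
    where
    μ = arr s markA
    I : ℕ → Arr → Set
    I i A = A markA ≡ μ × Stripping κ i (A colourA)
    start : Stripping κ 0 (arr s colourA)
    start rewrite κ≡ = record { consistent = con ; roots = roots ; extends = ⊑-refl ; progress = inj₁ ((λ _ → refl) , λ _ ()) }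
    step : ∀ v s → reg s 0 ≡ toℕ v → I (toℕ v) (arr s) → I (suc (toℕ v)) (arr (run D settleUnmarked s))
    step v s v≡ (μ≡ , st) = when-rule D unmarkedTest settle! s (I (suc (toℕ v)))
      (λ { (free , unmarked) → μ≡ , subst (Stripping κ (suc (toℕ v))) settled
             (stripping-settle v st (trans (sym hereκ) free) λ w κw fw≡v → complete w κw (trans (cong (μ !_) fw≡v) (trans (sym hereμ) unmarked))) })
      (λ no! → μ≡ , stripping-skip v st λ κv → sound v λ μv → no! (trans hereκ κv , trans hereμ μv))
      where
      hereκ : arr s colourA (reg s 0) ≡ arr s colourA ! v
      hereκ = cong (arr s colourA) v≡
      hereμ : arr s markA (reg s 0) ≡ μ ! v
      hereμ = cong₂ (λ r i → r i) μ≡ v≡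
      settled : settle (arr s colourA) v ≡ arr (run D settle! s) colourA
      settled = cong₂ (λ i j → update (update (arr s colourA) i 1) j 2) (sym v≡)
        (sym (parent-value (var 0) (setArr colourA (reg s 0) 1 s) v v≡))

  strip-spec : ∀ s → (∀ (v : Fin n) → arr s colourA ! v ≡ 0) → let κ = arr (run D strip s) colourA in
    Consistent κ × RootsOf (λ _ → ⊥) κ × Stuck κ
  strip-spec s blank = let con , roots , stuck = for-rule D stripRound I step s start in con , roots , coloured-stuck (arr (run D strip s) colourA) stuck
    where
    I : ℕ → Arr → Set
    I i A = Consistent (A colourA) × RootsOf (λ _ → ⊥) (A colourA) × (Stuck (A colourA) ⊎ i ≤ coloured (A colourA))
    start : I 0 (arr s)
    start .proj₁ .colour v = ≤-trans (≤-reflexive (blank v)) z≤n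
    start .proj₁ .leaf-parent v leafv = contradiction (trans (sym (blank v)) leafv) λ ()
    start .proj₁ .free-parent v _ leafp = contradiction (trans (sym (blank (f v))) leafp) λ ()
    start .proj₂ .proj₁ u rootu = contradiction (trans (sym (blank u)) rootu) λ ()
    start .proj₂ .proj₂ = inj₂ z≤n
    step : ∀ v s → reg s 1 ≡ toℕ v → I (toℕ v) (arr s) → I (suc (toℕ v)) (arr (run D stripRound s))
    step v s _ (con , roots , before) = consistent , roots′ , stripping-end stripped before
      where
      κ = arr s colourA
      s₁ = run D (for clearMark) s
      s₂ = run D (for markParent) s₁
      κ₁≡ : arr s₁ colourA ≡ κ
      κ₁≡ = frame D colourA (for clearMark) s refl
      stripped : Stripping κ n (arr (run D (for settleUnmarked) s₂) colourA)
      stripped = settleUnmarked-spec s₂ κ (trans (frame D colourA (for markParent) s₁ refl) κ₁≡)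
        (subst (λ κ → Marked κ (arr s₂ markA)) κ₁≡ (markParents-spec s₁ (clearMarks-spec s))) con roots
      open Stripping stripped using (consistent) renaming (roots to roots′)

  sweepAt-spec : ∀ k κ σ₀ c₀ v s → reg s 1 ≡ toℕ v → arr s colourA ≡ κ →
    Sweeping κ k σ₀ c₀ (toℕ v) (arr s stampA) (arr s clockA 0) →
    Sweeping κ k σ₀ c₀ (suc (toℕ v)) (arr (run D (sweepAt k) s) stampA) (arr (run D (sweepAt k) s) clockA 0)
  sweepAt-spec k κ σ₀ c₀ v s v≡ κ≡ sw = finish s₃
    (trans (cong (λ r → r 0) (frame D curA (seek stampA) s₂ refl)) cur₂)
    (trans (cong (λ r → r 0) (frame D countA (seek stampA) s₂ refl)) (trans (countLeaves-spec curA (λ ()) s₁ v v≡) (cong (λ κ → leaves κ v) κ≡)))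
    (subst (λ σ → SeekResult σ v (arr s₃ flagA 0)) σ₂≡ (seek-spec stampA (λ ()) s₂ v cur₂))
    (subst₂ (Sweeping κ k σ₀ c₀ (toℕ v)) (sym (trans (frame D stampA (seek stampA) s₂ refl) σ₂≡))
      (sym (cong (λ r → r 0) (trans (frame D clockA (seek stampA) s₂ refl) (frame D clockA (countLeaves curA) s₁ refl)))) sw)
    (trans (frame D stampA (seek stampA) s₂ refl) σ₂≡)
    where
    s₁ = run D {1} (assign! curA (var 1)) s
    s₂ = run D (countLeaves curA) s₁
    s₃ = run D (seek stampA) s₂
    cur₂ : arr s₂ curA 0 ≡ toℕ v
    cur₂ = trans (cong (λ r → r 0) (frame D curA (countLeaves curA) s₁ refl)) v≡
    σ₂≡ : arr s₂ stampA ≡ arr s stampA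
    σ₂≡ = frame D stampA (countLeaves curA) s₁ refl
    finish : ∀ t → arr t curA 0 ≡ toℕ v → arr t countA 0 ≡ leaves κ v → SeekResult (arr s stampA) v (arr t flagA 0) →
      Sweeping κ k σ₀ c₀ (toℕ v) (arr t stampA) (arr t clockA 0) → arr t stampA ≡ arr s stampA →
      let t′ = run D (when (sweepTest k) select! ▹ tick) t in
      Sweeping κ k σ₀ c₀ (suc (toℕ v)) (arr t′ stampA) (arr t′ clockA 0)
    finish t cur count (none , some) sw σ≡ = when-rule D (sweepTest k) select! t
      (λ A → Sweeping κ k σ₀ c₀ (suc (toℕ v)) (A stampA) (suc (A clockA 0)))
      (λ { (large , flag , out) → subst (λ i → Sweeping κ k σ₀ c₀ (suc (toℕ v)) (update (arr t stampA) i (suc (arr t clockA 0))) (suc (arr t clockA 0)))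
             (sym cur) (sweeping-select v sw (subst (k ≤_) count (≮⇒≥ large)) (subst (λ σ → ¬ Dominated σ v) (sym σ≡) (none flag)) (trans (sym (cong (arr t stampA) cur)) out)) })
      (λ no! → sweeping-skip v sw λ k≤ → choose no! k≤ (arr t flagA 0 ≟ 0))
      where
      choose : ¬ Holds D (sweepTest k) t → k ≤ leaves κ v → Dec (arr t flagA 0 ≡ 0) → Dominated (arr t stampA) v ⊎ arr t stampA ! v ≢ 0
      choose no! k≤ (no flag)  = inj₁ (subst (λ σ → Dominated σ v) (sym σ≡) (some flag))
      choose no! k≤ (yes flag) = inj₂ λ out → no! (≤⇒≯ (subst (k ≤_) (sym count) k≤) , flag , trans (cong (arr t stampA) cur) out)

  sweep-spec : ∀ k s → let κ = arr s colourA ; σ = arr s stampA ; s′ = run D (sweep k) s in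
    Stamped σ (arr s clockA 0) → (∀ t → σ ! t ≢ 0 → k ≤ leaves κ t) → (∀ u → k < leaves κ u → Covered κ σ u) →
    Sweeping κ k σ (arr s clockA 0) n (arr s′ stampA) (arr s′ clockA 0)
  sweep-spec k s st rich cov = for-rule D (sweepAt k) I step s (refl , sweeping-start st rich cov) .proj₂
    where
    κ = arr s colourA
    I : ℕ → Arr → Set
    I i A = A colourA ≡ κ × Sweeping κ k (arr s stampA) (arr s clockA 0) i (A stampA) (A clockA 0)
    step : ∀ v s → reg s 1 ≡ toℕ v → I (toℕ v) (arr s) → I (suc (toℕ v)) (arr (run D (sweepAt k) s))
    step v s v≡ (κ≡ , sw) = trans (frame D colourA (sweepAt k) s refl) κ≡ , sweepAt-spec k κ _ _ v s v≡ κ≡ sw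

-- Cycles

module BreakingCycles {n : ℕ} (D : Digraph n) (f : Fin n → Fin n) (f-edge : ∀ v → D ⟨ f v ⟶ v ⟩) where
  open Selection D f f-edge

  -- The two ways to pay for a leafless root: a dominated one stays out of Q, and one with a
  -- selected child `a` is traded against `a`, since the edge between them keeps one of the two out
  -- of Q.
  Orphan : Row → Fin n → Set
  Orphan σ u = Dominated σ u ⊎ (∃[ a ] σ ! a ≢ 0 × f a ≡ u)

  Orphan-mono : ∀ {σ σ′} → σ ⊑ σ′ → ∀ {u} → Orphan σ u → Orphan σ′ u
  Orphan-mono le (inj₁ dom)            = inj₁ (Dominated-mono le dom)
  Orphan-mono le (inj₂ (a , a≢0 , fa)) = inj₂ (a , a≢0 ∘ ⊑-free le a , fa)

  -- `rich` asks for a single leaf, although the sweeps so far guarantee two, because a vertex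
  -- selected while breaking a cycle brings only one.
  record Cycling (κ₀ σ₀ : Row) (c₀ i : ℕ) (κ σ : Row) (c : ℕ) : Set where
    field
      clock      : c ≡ c₀ + i
      consistent : Consistent κ
      stuck      : Stuck κ
      extendsκ   : κ₀ ⊑ κ
      extendsσ   : σ₀ ⊑ σ
      done       : ∀ (v : Fin n) → toℕ v < i → κ ! v ≢ 0
      roots      : RootsOf (Orphan σ) κ
      stamped    : Stamped σ c
      rich       : ∀ t → σ ! t ≢ 0 → HasLeaf κ t

  -- Exceptional roots must be old: a vertex that was free when the walk started owes its
  -- root status to a leaf.
  OldOrphan : Row → Row → Fin n → Set
  OldOrphan κ σ u = κ ! u ≡ 2 × Orphan σ u

  module _ {κ₀ σ₀ c₀ κ σ c} (v : Fin n) (cy : Cycling κ₀ σ₀ c₀ (toℕ v) κ σ c) where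
    open Cycling cy

    private
      clock′ : suc c ≡ c₀ + suc (toℕ v)
      clock′ = trans (cong suc clock) (sym (+-suc c₀ (toℕ v)))

      done′ : ∀ {κ′} → κ ⊑ κ′ → κ′ ! v ≢ 0 → ∀ w → toℕ w < suc (toℕ v) → κ′ ! w ≢ 0
      done′ le v≢0 w w≤v with w F.≟ v
      ... | yes refl = v≢0
      ... | no w≢v   = done w (≤∧≢⇒< (s≤s⁻¹ w≤v) (w≢v ∘ toℕ-injective)) ∘ ⊑-free le w

    cycling-skip : κ ! v ≢ 0 → Cycling κ₀ σ₀ c₀ (suc (toℕ v)) κ σ (suc c)
    cycling-skip v≢0 = record
      { clock = clock′ ; consistent = consistent ; stuck = stuck ; extendsκ = extendsκ ; extendsσ = extendsσ
      ; done = done′ ⊑-refl v≢0 ; roots = roots ; stamped = stamped-tick stamped ; rich = rich }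

    old-roots : RootsOf (OldOrphan κ σ) κ
    old-roots u rootu with roots u rootu
    ... | inj₁ has = inj₁ has
    ... | inj₂ o   = inj₂ (rootu , o)

    module _ {κ′ x y} (vfree : κ ! v ≡ 0) (w : Walking (OldOrphan κ σ) κ κ′ x y) (ended : κ′ ! f y ≢ 0) where
      private
        module W = Walking w

      stuck′ : Stuck κ′
      stuck′ = walking-stuck w ended

      -- The start x is excused by σ or has received a leaf.
      cycling-keep : Orphan σ x ⊎ HasLeaf κ′ x → κ′ ! v ≢ 0 →
        Cycling κ₀ σ₀ c₀ (suc (toℕ v)) κ′ σ (suc c)
      cycling-keep why v≢0 = record
        { clock = clock′ ; consistent = W.consistent ; stuck = stuck′
        ; extendsκ = ⊑-trans extendsκ W.extends ; extendsσ = extendsσ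
        ; done = done′ W.extends v≢0 ; roots = roots′ ; stamped = stamped-tick stamped
        ; rich = λ t t≢0 → HasLeaf-mono W.extends (rich t t≢0) }
        where
        roots′ : RootsOf (Orphan σ) κ′
        roots′ u rootu with W.roots u rootu
        ... | inj₁ has            = inj₁ has
        ... | inj₂ (inj₁ (_ , o)) = inj₂ o
        ... | inj₂ (inj₂ refl)    = [ inj₂ , inj₁ ]′ why

      -- When the walk is over, `f` again maps free vertices to free vertices; as the start `f v` is
      -- coloured, `v` must be coloured too.
      visited-child : x ≡ f v → κ′ ! v ≢ 0
      visited-child refl v≡0 = W.started (stuck-closed κ′ stuck′ v v≡0)

      -- Since the start `f v` is bare, `v` is not a leaf, hence a root. It was free before the walk
      -- and differs from the start, so it must own a leaf; thus selecting it preserves `rich`.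
      cycling-select : x ≡ f v → ¬ Dominated σ v → ¬ HasLeaf κ′ x →
        Cycling κ₀ σ₀ c₀ (suc (toℕ v)) κ′ (set σ v (suc c)) (suc c)
      cycling-select refl ¬dom bare = record
        { clock = clock′ ; consistent = W.consistent ; stuck = stuck′
        ; extendsκ = ⊑-trans extendsκ W.extends ; extendsσ = ⊑-trans extendsσ le
        ; done = done′ W.extends (visited-child refl) ; roots = roots′
        ; stamped = stamped-select stamped v ¬dom ; rich = rich′ }
        where
        unselected : σ ! v ≡ 0
        unselected with σ ! v ≟ 0
        ... | yes z = z
        ... | no nz = contradiction (trans (sym vfree) (HasLeaf-root consistent (rich v nz))) λ ()
        le : σ ⊑ set σ v (suc c)
        le = select-⊑ σ {v} (suc c) unselected
        roots′ : RootsOf (Orphan (set σ v (suc c))) κ′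
        roots′ u rootu with W.roots u rootu
        ... | inj₁ has            = inj₁ has
        ... | inj₂ (inj₁ (_ , o)) = inj₂ (Orphan-mono le o)
        ... | inj₂ (inj₂ refl)    = inj₂ (inj₂ (v , (λ z → contradiction (trans (sym z) (set-same σ v (suc c))) λ ()) , refl))
        leaf-v : HasLeaf κ′ v
        leaf-v with colourOf W.consistent v
        ... | isFree z = ⊥-elim (visited-child refl z)
        ... | isLeaf l = ⊥-elim (bare (v , l , refl))
        ... | isRoot r with W.roots v r
        ...   | inj₁ has            = has
        ...   | inj₂ (inj₁ (o , _)) = contradiction (trans (sym vfree) o) λ ()
        ...   | inj₂ (inj₂ v≡fv)    = ⊥-elim (f≢ v (sym v≡fv))
        rich′ : ∀ t → set σ v (suc c) ! t ≢ 0 → HasLeaf κ′ t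
        rich′ t t≢0 with t F.≟ v
        ... | yes refl = leaf-v
        ... | no t≢v   = HasLeaf-mono W.extends (rich t (t≢0 ∘ trans (set-other σ (suc c) t≢v)))

-- Specifications of the walk and of breaking a cycle

module CycleSpecs {n : ℕ} (D : Digraph n) (f : Fin n → Fin n) (f-edge : ∀ v → D ⟨ f v ⟶ v ⟩)
  (f-first : ∀ v → nth (map toℕ (elements (N⁻ D v))) 0 ≡ toℕ (f v)) where
  open Selection D f f-edge
  open BreakingCycles D f f-edge
  open Specs D f f-edge f-first

  -- A fixed loop of `n` steps is long enough: each step before the end colours the free vertex
  -- `f y`.
  walk-spec : ∀ {E} s x κ → arr s colourA ≡ κ → arr s startA 0 ≡ toℕ x →
    Consistent κ → RootsOf E κ → Stuck κ → κ ! x ≡ 0 →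
    ∃[ y ] Walking E κ (arr (run D walk s) colourA) x y × arr (run D walk s) colourA ! f y ≢ 0
  walk-spec {E} s x κ κ≡ x≡ con roots stuck xfree = finish (for-rule D walkStep I step s₁ start)
    where
    s₁ = run D {1} (put colourA (cell startA) (lit 2) ▹ assign! walkA (cell startA)) s
    I : ℕ → Arr → Set
    I i A = ∃[ y ] A walkA 0 ≡ toℕ y × Walking E κ (A colourA) x y × (A colourA ! f y ≢ 0 ⊎ i ≤ coloured (A colourA))
    start : I 0 (arr s₁)
    start = x , x≡ , subst (λ κ′ → Walking E κ κ′ x x) (cong₂ (λ r i → update r i 2) (sym κ≡) (sym x≡))
              (walking-start con roots stuck xfree) , inj₂ z≤n
    step : ∀ v s → reg s 0 ≡ toℕ v → I (toℕ v) (arr s) → I (suc (toℕ v)) (arr (run D walkStep s))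
    step v s _ (y , y≡ , w , progress) = when-rule D walkTest walkOn s (I (suc (toℕ v)))
      (λ free → let fy≡0 = trans (cong (arr s colourA) (sym c≡)) free in
        f (f y) , trans (parent-value (parent (cell walkA)) s₂ (f y) c≡) refl
        , subst (λ κ′ → Walking E κ κ′ x (f (f y))) settled (walking-step stuck w fy≡0)
        , inj₂ (subst (λ κ′ → suc (toℕ v) ≤ coloured κ′) settled
            ([ (λ fy≢0 → ⊥-elim (fy≢0 fy≡0))
             , (λ v≤ → ≤-trans (s≤s v≤) (coloured-strict (settle-⊑ (w .Walking.consistent) fy≡0) (f y) fy≡0
                 λ z → contradiction (trans (sym z) (settle-leaf (arr s colourA) (f y))) λ ())) ]′ progress)))
      (λ no! → y , y≡ , w , inj₁ λ z → no! (trans (cong (arr s colourA) c≡) z))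
      where
      c≡ : ⟦ parent (cell walkA) ⟧ D s ≡ toℕ (f y)
      c≡ = parent-value (cell walkA) s y y≡
      s₂ = run D {0} (put colourA (parent (cell walkA)) (lit 1)) s
      settled : settle (arr s colourA) (f y) ≡ arr (run D walkOn s) colourA
      settled = cong₂ (λ i j → update (update (arr s colourA) i 1) j 2) (sym c≡)
        (sym (parent-value (parent (cell walkA)) s₂ (f y) c≡))
    κ′ = arr (run D walk s) colourA
    finish : I n (arr (run D walk s)) → ∃[ y ] Walking E κ κ′ x y × κ′ ! f y ≢ 0
    finish (y , _ , w , inj₁ ended) = y , w , ended
    finish (y , _ , w , inj₂ full)  = y , w , all-coloured κ′ full (f y)

  StartsAt : Fin n → ℕ → Fin n → Set
  StartsAt v flag x = (flag ≢ 0 × x ≡ v) ⊎ (flag ≡ 0 × x ≡ f v)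

  chooseStart-spec : ∀ s v → arr s curA 0 ≡ toℕ v →
    ∃[ x ] arr (run D chooseStart s) startA 0 ≡ toℕ x × StartsAt v (arr s flagA 0) x
  chooseStart-spec s v cur = when-rule D dominatedTest (assign! startA (cell curA)) s₁
    (λ A → ∃[ x ] A startA 0 ≡ toℕ x × StartsAt v (arr s flagA 0) x)
    (λ flag → v , cur , inj₁ (flag , refl))
    (λ flag → f v , parent-value (cell curA) s v cur , inj₂ (decidable-stable (arr s flagA 0 ≟ 0) flag , refl))
    where
    s₁ = run D {1} (assign! startA (parent (cell curA))) s

  breakCycle-spec : ∀ κ₀ σ₀ c₀ v s → arr s curA 0 ≡ toℕ v → arr s colourA ! v ≡ 0 →
    Cycling κ₀ σ₀ c₀ (toℕ v) (arr s colourA) (arr s stampA) (arr s clockA 0) →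
    let s′ = run D breakCycle s in
    Cycling κ₀ σ₀ c₀ (suc (toℕ v)) (arr s′ colourA) (arr s′ stampA) (suc (arr s′ clockA 0))
  breakCycle-spec κ₀ σ₀ c₀ v s cur vfree cy =
    let x , x≡ , starts = chooseStart-spec s₁ v cur₁
        y , w , ended   = walk-spec s₂ x κ (kept₂ colourA refl refl) x≡ consistent (old-roots v cy) stuck (xfree starts)
        start₃ : arr s₃ startA 0 ≡ toℕ x
        start₃ = trans (cong (λ r → r 0) (frame D startA walk s₂ refl)) x≡
    in finish s₄ x y
         (trans (kept₃ stampA refl refl refl refl) refl)
         (trans (cong (λ r → r 0) (kept₃ clockA refl refl refl refl)) refl)
         (trans (cong (λ r → r 0) (kept₃ curA refl refl refl refl)) cur)
         (subst (λ flag → StartsAt v flag x) (sym (cong (λ r → r 0) flag₄)) starts)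
         (subst (λ flag → SeekResult σ v flag) (sym (cong (λ r → r 0) flag₄)) (seek-spec stampA (λ ()) s v cur))
         (trans (countLeaves-spec startA (λ ()) s₃ x start₃) (cong (λ κ → leaves κ x) (sym (frame D colourA (countLeaves startA) s₃ refl))))
         (subst (λ κ′ → Walking (OldOrphan κ σ) κ κ′ x y) (sym (frame D colourA (countLeaves startA) s₃ refl)) w)
         (subst (λ κ′ → κ′ ! f y ≢ 0) (sym (frame D colourA (countLeaves startA) s₃ refl)) ended)
    where
    open Cycling cy
    κ  = arr s colourA
    σ  = arr s stampA
    s₁ = run D (seek stampA) s
    s₂ = run D chooseStart s₁
    s₃ = run D walk s₂
    s₄ = run D (countLeaves startA) s₃
    kept₂ : ∀ a → touches a (seek stampA) ≡ false → touches a chooseStart ≡ false → arr s₂ a ≡ arr s a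
    kept₂ a t₁ t₂ = trans (frame D a chooseStart s₁ t₂) (frame D a (seek stampA) s t₁)
    kept₃ : ∀ a → touches a (seek stampA) ≡ false → touches a chooseStart ≡ false → touches a walk ≡ false →
      touches a (countLeaves startA) ≡ false → arr s₄ a ≡ arr s a
    kept₃ a t₁ t₂ t₃ t₄ = trans (frame D a (countLeaves startA) s₃ t₄) (trans (frame D a walk s₂ t₃) (kept₂ a t₁ t₂))
    flag₄ : arr s₄ flagA ≡ arr s₁ flagA
    flag₄ = trans (frame D flagA (countLeaves startA) s₃ refl) (trans (frame D flagA walk s₂ refl) (frame D flagA chooseStart s₁ refl))
    cur₁ : arr s₁ curA 0 ≡ toℕ v
    cur₁ = trans (cong (λ r → r 0) (frame D curA (seek stampA) s refl)) cur
    xfree : ∀ {flag x} → StartsAt v flag x → κ ! x ≡ 0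
    xfree (inj₁ (_ , refl)) = vfree
    xfree (inj₂ (_ , refl)) = stuck-closed κ stuck v vfree
    finish : ∀ t x y → arr t stampA ≡ σ → arr t clockA 0 ≡ arr s clockA 0 → arr t curA 0 ≡ toℕ v →
      StartsAt v (arr t flagA 0) x → SeekResult σ v (arr t flagA 0) → arr t countA 0 ≡ leaves (arr t colourA) x →
      Walking (OldOrphan κ σ) κ (arr t colourA) x y → arr t colourA ! f y ≢ 0 →
      let t′ = run D (when bareTest select!) t in
      Cycling κ₀ σ₀ c₀ (suc (toℕ v)) (arr t′ colourA) (arr t′ stampA) (suc (arr t′ clockA 0))
    finish t x y σ≡ c≡ cur starts (none , some) count w ended = when-rule D bareTest select! t
      (λ A → Cycling κ₀ σ₀ c₀ (suc (toℕ v)) (A colourA) (A stampA) (suc (A clockA 0)))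
      (λ { (flag , bare) → let x≡fv = child flag starts in
           subst₂ (Cycling κ₀ σ₀ c₀ (suc (toℕ v)) κ′)
             (trans (cong₂ (λ σ c → set σ v (suc c)) (sym σ≡) (sym c≡)) (cong (λ i → update (arr t stampA) i (suc (arr t clockA 0))) (sym cur)))
             (cong suc (sym c≡))
             (cycling-select v cy vfree w ended x≡fv (none flag) λ has →
               contradiction (subst (1 ≤_) (trans (sym count) bare) (HasLeaf⇒leaves κ′ has)) λ ()) })
      (λ no! → subst₂ (λ σ c → Cycling κ₀ σ₀ c₀ (suc (toℕ v)) κ′ σ (suc c)) (sym σ≡) (sym c≡) (keep no! starts))
      where
      κ′ = arr t colourA
      child : arr t flagA 0 ≡ 0 → StartsAt v (arr t flagA 0) x → x ≡ f v
      child flag (inj₁ (flag≢0 , _)) = ⊥-elim (flag≢0 flag)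
      child flag (inj₂ (_ , x≡fv))   = x≡fv
      keep : ¬ Holds D bareTest t → StartsAt v (arr t flagA 0) x → Cycling κ₀ σ₀ c₀ (suc (toℕ v)) κ′ σ (suc (arr s clockA 0))
      keep no! (inj₁ (flag , refl)) = cycling-keep v cy vfree w ended (inj₁ (inj₁ (some flag))) (w .Walking.started)
      keep no! (inj₂ (flag , x≡fv)) = cycling-keep v cy vfree w ended
        (inj₂ (leaves⇒HasLeaf κ′ x (n≢0⇒n>0 λ z → no! (flag , trans count z)))) (visited-child v cy vfree w ended x≡fv)

  cycles-spec : ∀ s → let κ = arr s colourA ; σ = arr s stampA ; s′ = run D cycles s in
    Consistent κ → RootsOf (λ _ → ⊥) κ → Stuck κ → Stamped σ (arr s clockA 0) → (∀ t → σ ! t ≢ 0 → HasLeaf κ t) →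
    Cycling κ σ (arr s clockA 0) n (arr s′ colourA) (arr s′ stampA) (arr s′ clockA 0)
  cycles-spec s con roots stuck st rich = for-rule D cycleAt I step s start
    where
    I : ℕ → Arr → Set
    I i A = Cycling (arr s colourA) (arr s stampA) (arr s clockA 0) i (A colourA) (A stampA) (A clockA 0)
    start : I 0 (arr s)
    start = record
      { clock = sym (+-identityʳ _) ; consistent = con ; stuck = stuck ; extendsκ = ⊑-refl ; extendsσ = ⊑-refl
      ; done = λ v () ; roots = λ u rootu → [ inj₁ , ⊥-elim ]′ (roots u rootu) ; stamped = st ; rich = rich }
    step : ∀ v s → reg s 1 ≡ toℕ v → I (toℕ v) (arr s) → I (suc (toℕ v)) (arr (run D cycleAt s))
    step v s v≡ cy = when-rule D curFreeTest breakCycle s₁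
      (λ A → Cycling _ _ _ (suc (toℕ v)) (A colourA) (A stampA) (suc (A clockA 0)))
      (λ free → breakCycle-spec _ _ _ v s₁ v≡ (trans (cong (arr s colourA) (sym v≡)) free) cy)
      (λ ¬free → cycling-skip v cy λ z → ¬free (trans (cong (arr s colourA) v≡) z))
      where
      s₁ = run D {1} (assign! curA (var 1)) s

-- Specification of the backward scan

module PeelSpecs {n : ℕ} (D : Digraph n) (f : Fin n → Fin n) (f-edge : ∀ v → D ⟨ f v ⟶ v ⟩)
  (f-first : ∀ v → nth (map toℕ (elements (N⁻ D v))) 0 ≡ toℕ (f v)) where
  open Selection D f f-edge
  open Specs D f f-edge f-first

  Hits : Row → ℕ → Fin n → Set
  Hits σ c x = ∀ (w : Fin n) → σ ! w ≡ c → σ ! x ≡ c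

  find-spec : ∀ s (v : Fin n) σ c → arr s curA 0 ≡ toℕ v → arr s stampA ≡ σ → arr s clockA 0 ≡ c →
    ∃[ x ] arr (run D (for findStep) s) curA 0 ≡ toℕ x × Hits σ c x
  find-spec s v σ c cur σ≡ c≡ =
    let _ , _ , x , x≡ , found = for-rule D findStep I step s (σ≡ , c≡ , v , cur , λ _ ()) in x , x≡ , λ w → found w (toℕ<n w)
    where
    I : ℕ → Arr → Set
    I i A = A stampA ≡ σ × A clockA 0 ≡ c × (∃[ x ] A curA 0 ≡ toℕ {n} x × (∀ (w : Fin n) → toℕ w < i → σ ! w ≡ c → σ ! x ≡ c))
    step : ∀ v s → reg s 0 ≡ toℕ v → I (toℕ v) (arr s) → I (suc (toℕ v)) (arr (run D findStep s))
    step v s v≡ (σ≡ , c≡ , x , x≡ , found) = when-rule D stampTest (assign! curA (var 0)) s (I (suc (toℕ v)))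
      (λ hit → σ≡ , c≡ , v , v≡ , λ _ _ _ → trans (sym here) (trans hit c≡))
      (λ miss → σ≡ , c≡ , x , x≡ , λ w w≤v w≡c → found w (≤∧≢⇒< (s≤s⁻¹ w≤v) λ w≡v →
        miss (trans here (trans (cong σ (sym w≡v)) (trans w≡c (sym c≡))))) w≡c)
      where
      here : arr s stampA (reg s 0) ≡ σ ! v
      here = cong₂ (λ r i → r i) σ≡ v≡

  peelAt-spec : ∀ s v σ c₀ → reg s 1 ≡ toℕ v → arr s stampA ≡ σ → Stamped σ c₀ →
    Peeling σ (arr s clockA 0) (arr s selectedA) →
    let s′ = run D peelAt s in
    Peeling σ (arr s′ clockA 0) (arr s′ selectedA) × arr s′ clockA 0 ≡ arr s clockA 0 ∸ 1
  peelAt-spec s v σ c₀ v≡ σ≡ st p =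
    let x , x≡ , found = find-spec s₁ v σ (arr s clockA 0) v≡ σ≡ refl
        cur₃ = trans (cong (λ r → r 0) (frame D curA (seek selectedA) s₂ refl)) x≡
        sel₃ : arr s₃ selectedA ≡ arr s selectedA
        sel₃ = trans (frame D selectedA (seek selectedA) s₂ refl) (frame D selectedA (for findStep) s₁ refl)
        clk₃ : arr s₃ clockA 0 ≡ arr s clockA 0
        clk₃ = cong (λ r → r 0) (trans (frame D clockA (seek selectedA) s₂ refl) (frame D clockA (for findStep) s₁ refl))
        stamp₃ : arr s₃ stampA ≡ σ
        stamp₃ = trans (trans (frame D stampA (seek selectedA) s₂ refl) (frame D stampA (for findStep) s₁ refl)) σ≡
        seen = subst (λ q → SeekResult q x (arr s₃ flagA 0)) (sym (frame D selectedA (seek selectedA) s₂ refl)) (seek-spec selectedA (λ ()) s₂ x x≡)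
    in finish s₃ x cur₃ stamp₃ clk₃ seen (subst (λ c → Hits σ c x) (sym clk₃) found)
         (subst₂ (Peeling σ) (sym clk₃) (sym sel₃) p)
    where
    s₁ = run D {1} (assign! curA (var 1)) s
    s₂ = run D (for findStep) s₁
    s₃ = run D (seek selectedA) s₂
    finish : ∀ t x → arr t curA 0 ≡ toℕ x → arr t stampA ≡ σ → arr t clockA 0 ≡ arr s clockA 0 →
      SeekResult (arr t selectedA) x (arr t flagA 0) → Hits σ (arr t clockA 0) x →
      Peeling σ (arr t clockA 0) (arr t selectedA) →
      let t′ = run D {1} (when peelTest (put selectedA (cell curA) (lit 1)) ▹ assign! clockA (cell clockA ⊖ lit 1)) t in
      Peeling σ (arr t′ clockA 0) (arr t′ selectedA) × arr t′ clockA 0 ≡ arr s clockA 0 ∸ 1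
    finish t x cur σ≡ c≡ (none , some) found p = when-rule D {1} peelTest (put selectedA (cell curA) (lit 1)) t
      (λ A → Peeling σ (A clockA 0 ∸ 1) (A selectedA) × A clockA 0 ∸ 1 ≡ arr s clockA 0 ∸ 1)
      (λ { (hit , flag , clk) → subst (λ i → Peeling σ (arr t clockA 0 ∸ 1) (update (arr t selectedA) i 1)) (sym cur)
             (hitCase (arr t clockA 0) refl (trans (sym here) hit) flag clk p) , cong (_∸ 1) c≡ })
      (λ no! → missCase (arr t clockA 0) refl no! found p , cong (_∸ 1) c≡)
      where
      here : arr t stampA (arr t curA 0) ≡ σ ! x
      here = cong₂ (λ r i → r i) σ≡ cur
      hitCase : ∀ c → arr t clockA 0 ≡ c → σ ! x ≡ c → arr t flagA 0 ≡ 0 → c ≢ 0 → Peeling σ c (arr t selectedA) →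
        Peeling σ (c ∸ 1) (set (arr t selectedA) x 1)
      hitCase zero    _ _  _    c≢0 _ = ⊥-elim (c≢0 refl)
      hitCase (suc c) _ x≡ flag _   p = peeling-select st p x x≡ (none flag)
      missCase : ∀ c → arr t clockA 0 ≡ c → ¬ Holds D peelTest t → Hits σ c x →
        Peeling σ c (arr t selectedA) → Peeling σ (c ∸ 1) (arr t selectedA)
      missCase zero    _ _ _ p = p
      missCase (suc c) tc no! found p = peeling-skip st p dominated
        where
        dominated : ∀ (w : Fin n) → σ ! w ≡ suc c → Dominated (arr t selectedA) w
        dominated w w≡ with x≡ ← found w w≡
          with refl ← st .distinct x w (λ z → contradiction (trans (sym x≡) z) λ ()) (trans x≡ (sym w≡))
          with arr t flagA 0 ≟ 0
        ... | no flag  = some flag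
        ... | yes flag = ⊥-elim (no! (trans here (trans x≡ (sym tc)) , flag , λ z → contradiction (trans (sym tc) z) λ ()))

  Peeled : Row → ℕ → Arr → Set
  Peeled σ c A = A stampA ≡ σ × Peeling σ c (A selectedA) × A clockA 0 ≡ c

  peelRound-spec : ∀ s σ c₀ c → Stamped σ c₀ → Peeled σ c (arr s) → Peeled σ (c ∸ n) (arr (run D (for peelAt) s))
  peelRound-spec s σ c₀ c st (σ≡ , p , c≡) = for-rule D peelAt I step s (σ≡ , p , c≡)
    where
    I : ℕ → Arr → Set
    I i A = Peeled σ (c ∸ i) A
    step : ∀ v s → reg s 1 ≡ toℕ v → I (toℕ v) (arr s) → I (suc (toℕ v)) (arr (run D peelAt s))
    step v s v≡ (σ≡ , p , c≡) =
      let p′ , c′≡ = peelAt-spec s v σ c₀ v≡ σ≡ st (subst (λ c → Peeling σ c (arr s selectedA)) (sym c≡) p)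
          next≡ = trans c′≡ (trans (cong (_∸ 1) c≡) (trans (∸-+-assoc c (toℕ v) 1) (cong (c ∸_) (+-comm (toℕ v) 1))))
      in trans (frame D stampA peelAt s refl) σ≡ , subst (λ c → Peeling σ c (arr (run D peelAt s) selectedA)) next≡ p′ , next≡

  peelings-spec : ∀ m s σ c₀ c → Stamped σ c₀ → Peeled σ c (arr s) →
    Peeled σ (c ∸ suc m * n) (arr (run D (peelings m) s))
  peelings-spec zero    s σ c₀ c st p =
    subst (λ k → Peeled σ (c ∸ k) (arr (run D (for peelAt) s))) (sym (+-identityʳ n)) (peelRound-spec s σ c₀ c st p)
  peelings-spec (suc m) s σ c₀ c st p =
    subst (λ k → Peeled σ k (arr (run D (peelings (suc m)) s))) (∸-+-assoc c n (suc m * n))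
      (peelings-spec m (run D (for peelAt) s) σ c₀ (c ∸ n) st (peelRound-spec s σ c₀ c st p))

-- The quasi-kernel

N⁻⇒edge : ∀ {n} (D : Digraph n) u v → u ∈ N⁻ D v → D ⟨ u ⟶ v ⟩
N⁻⇒edge D u v u∈ = lookup⇒[]= v (N⁺ D u) (trans (sym (lookup∘tabulate (λ u → lookup (N⁺ D u) v) u)) ([]=⇒lookup u∈))

first-element : ∀ {n} (p : Subset n) → Nonempty p → ∃[ u ] nth (map toℕ (elements p)) 0 ≡ toℕ u × u ∈ p
first-element {n} p (x , x∈p) with elements p in listed
... | [] = contradiction (subst (x ∈ˡ_) listed (∈-filter⁺ (_∈? p) (∈-allFin x) x∈p)) λ ()
... | u ∷ us = u , refl , ∈-filter⁻ (_∈? p) {xs = allFin n} (subst (u ∈ˡ_) (sym listed) (Any.here refl)) .proj₂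

-- Sourcelessness supplies `f`, chosen as the in-neighbour that the machine lists first.
first-in-neighbour : ∀ {n} (D : Digraph n) → Sourceless D → ∀ v →
  ∃[ u ] nth (map toℕ (elements (N⁻ D v))) 0 ≡ toℕ u × D ⟨ u ⟶ v ⟩
first-in-neighbour {n} D sourceless v with nonempty? (N⁻ D v)
... | yes ne = let u , first , u∈ = first-element (N⁻ D v) ne in u , first , N⁻⇒edge D u v u∈
... | no empty = ⊥-elim (sourceless v (trans (cong ∣_∣ (Empty-unique empty)) (∣⊥∣≡0 n)))

≤foldr-⊔ : ∀ {A : Set} (g : A → ℕ) {x} xs → x ∈ˡ xs → g x ≤ foldr _⊔_ 0 (map g xs)
≤foldr-⊔ g (y ∷ xs) (Any.here refl) = m≤m⊔n (g y) _
≤foldr-⊔ g (y ∷ xs) (Any.there x∈)  = ≤-trans (≤foldr-⊔ g xs x∈) (m≤n⊔m (g y) _)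

outdegree≤Δ⁺ : ∀ {n} (D : Digraph n) v → outdegree D v ≤ Δ⁺ D
outdegree≤Δ⁺ {n} D v = ≤foldr-⊔ (outdegree D) (allFin n) (∈-allFin v)

-- Distances up to two

module Distances {n : ℕ} (D : Digraph n) where

  path₀⇒≡ : ∀ {v u} → Path D v u 0 → v ≡ u
  path₀⇒≡ p = trans (sym (p .Path.start)) (p .Path.end)

  path₁⇒edge : ∀ {v u} → Path D v u 1 → D ⟨ v ⟶ u ⟩
  path₁⇒edge p = subst₂ (D ⟨_⟶_⟩) (p .Path.start) (p .Path.end) (p .Path.edge 0F)

  dist₀ : ∀ v → IsDist D v v 0
  dist₀ v = record { vertex = λ _ → v ; distinct = λ { {0F} {0F} _ → refl } ; start = refl ; end = refl ; edge = λ () } , λ _ _ → z≤n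

  dist₁ : ∀ {v u} → v ≢ u → D ⟨ v ⟶ u ⟩ → IsDist D v u 1
  dist₁ {v} {u} v≢u e = record { vertex = vertex ; distinct = distinct ; start = refl ; end = refl ; edge = λ { 0F → e } } , minimal
    where
    vertex : Fin 2 → Fin n
    vertex 0F = v
    vertex 1F = u
    distinct : Injective _≡_ _≡_ vertex
    distinct {0F} {0F} _ = refl
    distinct {0F} {1F} v≡u = ⊥-elim (v≢u v≡u)
    distinct {1F} {0F} u≡v = ⊥-elim (v≢u (sym u≡v))
    distinct {1F} {1F} _ = refl
    minimal : ∀ j → Path D v u j → 1 ≤ j
    minimal zero    p = ⊥-elim (v≢u (path₀⇒≡ p))
    minimal (suc j) p = s≤s z≤n

  dist₂ : ∀ {v t u} → v ≢ u → ¬ D ⟨ v ⟶ u ⟩ → D ⟨ v ⟶ t ⟩ → D ⟨ t ⟶ u ⟩ → IsDist D v u 2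
  dist₂ {v} {t} {u} v≢u ¬e e e′ = record { vertex = vertex ; distinct = distinct ; start = refl ; end = refl
                                         ; edge = λ { 0F → e ; 1F → e′ } } , minimal
    where
    vertex : Fin 3 → Fin n
    vertex 0F = v
    vertex 1F = t
    vertex 2F = u
    v≢t : v ≢ t
    v≢t refl = loopless D v e
    t≢u : t ≢ u
    t≢u refl = loopless D t e′
    distinct : Injective _≡_ _≡_ vertex
    distinct {0F} {0F} _ = refl
    distinct {1F} {1F} _ = refl
    distinct {2F} {2F} _ = refl
    distinct {0F} {1F} p = ⊥-elim (v≢t p)
    distinct {1F} {0F} p = ⊥-elim (v≢t (sym p))
    distinct {0F} {2F} p = ⊥-elim (v≢u p)
    distinct {2F} {0F} p = ⊥-elim (v≢u (sym p))
    distinct {1F} {2F} p = ⊥-elim (t≢u p)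
    distinct {2F} {1F} p = ⊥-elim (t≢u (sym p))
    minimal : ∀ j → Path D v u j → 2 ≤ j
    minimal zero          p = ⊥-elim (v≢u (path₀⇒≡ p))
    minimal (suc zero)    p = ⊥-elim (¬e (path₁⇒edge p))
    minimal (suc (suc j)) p = s≤s (s≤s z≤n)

  Near : Fin n → Fin n → Set
  Near v u = ∃[ k ] IsDist D v u k × k ≤ 2

  near₁ : ∀ v u → D ⟨ v ⟶ u ⟩ → Near v u
  near₁ v u e = 1 , dist₁ (λ { refl → loopless D v e }) e , s≤s z≤n

  -- A walk of length two need not be a shortest path: its ends may coincide or be adjacent, and the
  -- distance is then 0 or 1.
  near₂ : ∀ v t u → D ⟨ v ⟶ t ⟩ → D ⟨ t ⟶ u ⟩ → Near v u
  near₂ v t u e e′ with v F.≟ u | u ∈? N⁺ D v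
  ... | yes refl | _      = 0 , dist₀ v , z≤n
  ... | no v≢u   | yes e″ = near₁ v u e″
  ... | no v≢u   | no ¬e  = 2 , dist₂ v≢u ¬e e e′ , ≤-refl

module _ {n : ℕ} (D : Digraph n) (f : Fin n → Fin n) (f-edge : ∀ v → D ⟨ f v ⟶ v ⟩) where
  open Selection D f f-edge

  -- A cycle vertex ends with at most one leaf, so two leaves mean that nothing has changed at u.
  covered-after-cycles : ∀ {κ₁ κ σ₂ σ₃} → Consistent κ₁ → Stuck κ₁ → κ₁ ⊑ κ → σ₂ ⊑ σ₃ → Swept κ₁ 2 σ₂ →
    ∀ u → 1 < leaves κ u → Covered κ σ₃ u
  covered-after-cycles {κ₁} con stuck extκ extσ swept u large with κ₁ ! u ≟ 0
  ... | yes free = ⊥-elim (<⇒≱ large (leaves-on-cycles con stuck extκ u free))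
  ... | no coloured with same ← leaves-off-cycles con stuck extκ u coloured
      with swept .Swept.covered u (≤-trans large same)
  ...   | inj₁ u≢0 = inj₁ (u≢0 ∘ ⊑-free extσ u)
  ...   | inj₂ (t , (t≢0 , edge) , u≤t) =
          inj₂ (t , (t≢0 ∘ ⊑-free extσ t , edge) , ≤-trans same (≤-trans u≤t (leaves-mono extκ t)))

-- From the final invariants to the small quasi-kernel

module Outcome {n : ℕ} (D : Digraph n) (f : Fin n → Fin n) (f-edge : ∀ v → D ⟨ f v ⟶ v ⟩)
  (d : ℕ) (2≤d : 2 ≤ d) (outdegree≤ : ∀ v → outdegree D v ≤ d) where
  open BreakingCycles D f f-edge
  open Selection D f f-edge
  open Distances D

  module Verdict
    {κ₁ κ σ₂ σ₃ σ₄ σ q : Row} {c₂ c₃ c₄ c₅ : ℕ}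
    (cycled : Cycling κ₁ σ₂ c₂ n κ σ₃ c₃)
    (sweeping₁ : Sweeping κ 1 σ₃ c₃ n σ₄ c₄) (sweeping₀ : Sweeping κ 0 σ₄ c₄ n σ c₅) (peeled : Peeling σ 0 q)
    (Q : Subset n) (Q⇒q : ∀ v → v ∈ Q → q ! v ≢ 0) (q⇒Q : ∀ v → q ! v ≢ 0 → v ∈ Q) where
    private
      module C = Cycling cycled
      swept₄ = sweeping-end sweeping₁
      swept₅ = sweeping-end sweeping₀
      stamped₄ = sweeping₁ .Sweeping.stamped
      stamped₅ = sweeping₀ .Sweeping.stamped

    module P = Peeling peeled

    independent : Independent D Q
    independent u v u∈ v∈ = P.independent u v (Q⇒q u u∈) (Q⇒q v v∈)

    absorbed : ∀ t → σ ! t ≢ 0 → t ∈ Q ⊎ (∃[ v ] v ∈ Q × D ⟨ v ⟶ t ⟩)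
    absorbed t t≢0 with P.absorbed t (n≢0⇒n>0 t≢0)
    ... | inj₁ sel              = inj₁ (q⇒Q t sel)
    ... | inj₂ (v , sel , edge) = inj₂ (v , q⇒Q v sel , edge)

    -- The sweep with threshold 0 leaves every vertex selected or dominated by a selected one, and
    -- absorption costs at most one further edge.
    reaches : ∀ u → ∃[ v ] v ∈ Q × Near v u
    reaches u with swept₅ .Swept.covered u z≤n
    reaches u | inj₁ u≢0 with absorbed u u≢0
    ... | inj₁ u∈              = u , u∈ , 0 , dist₀ u , z≤n
    ... | inj₂ (v , v∈ , edge) = v , v∈ , near₁ v u edge
    reaches u | inj₂ (t , (t≢0 , tu) , _) with absorbed t t≢0
    ... | inj₁ t∈              = t , t∈ , near₁ t u tu
    ... | inj₂ (v , v∈ , edge) = v , v∈ , near₂ v t u edge tu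

    -- This is T: the selection as it stands before the sweep with threshold 0.
    Early : Fin n → Set
    Early v = σ₄ ! v ≢ 0

    -- An edge from an early to a late vertex of the selection would point forwards.
    avoids : ∀ t u → Early t → ¬ Early u → D ⟨ t ⟶ u ⟩ → u ∉ Q
    avoids t u Tt ¬Tu edge u∈ = <-asym (stamped₅ .backward t u (Tt ∘ ⊑-free ext t) u≢0 edge)
      (≤-<-trans (≤-trans (≤-reflexive (ext .keeps t Tt)) (stamped₄ .bounded t))
        (sweeping₀ .Sweeping.recent u (decidable-stable (σ₄ ! u ≟ 0) ¬Tu) u≢0))
      where
      ext = sweeping₀ .Sweeping.extends
      u≢0 : σ ! u ≢ 0
      u≢0 z = <⇒≱ (P.selected u (Q⇒q u u∈)) (≤-reflexive z)

    -- If `u` has a leaf, the sweep with threshold 1 covers it. If not, breaking the cycles has left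
    -- `u` as an orphan, whose witness was selected before that sweep and so belongs to T.
    excuse : ∀ u → κ ! u ≡ 2 → ¬ Early u →
      (∃[ t ] Early t × D ⟨ t ⟶ u ⟩ × leaves κ u ≤ leaves κ t) ⊎ (leaves κ u ≡ 0 × (∃[ a ] Early a × f a ≡ u))
    excuse u rootu ¬Tu with leaves κ u in count
    ... | suc l with swept₄ .Swept.covered u (subst (1 ≤_) (sym count) z<s)
    ...   | inj₁ Tu = ⊥-elim (¬Tu Tu)
    ...   | inj₂ (t , (Tt , edge) , u≤t) = inj₁ (t , Tt , edge , subst (_≤ leaves κ t) count u≤t)
    excuse u rootu ¬Tu | zero with C.roots u rootu
    ... | inj₁ has = contradiction (subst (1 ≤_) count (HasLeaf⇒leaves κ has)) λ ()
    ... | inj₂ o with Orphan-mono (sweeping₁ .Sweeping.extends) o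
    ...   | inj₁ (t , Tt , edge) = inj₁ (t , Tt , edge , z≤n)
    ...   | inj₂ (a , Ta , fa)   = inj₂ (refl , a , Ta , fa)

    smallQuasiKernel : SmallQuasiKernel d D Q
    smallQuasiKernel = record
      { quasiKernel = record { independent = independent ; reaches = reaches }
      ; small = Counting.small D f f-edge d 2≤d outdegree≤ κ C.consistent (λ v → C.done v (toℕ<n v))
          Early (λ v → ¬? (σ₄ ! v ≟ 0)) (λ t Tt → swept₄ .Swept.rich t Tt) Q independent avoids excuse
      }

-- Correctness of the complete run

module Correctness {n : ℕ} (D : Digraph n) (f : Fin n → Fin n) (f-edge : ∀ v → D ⟨ f v ⟶ v ⟩)
  (f-first : ∀ v → nth (map toℕ (elements (N⁻ D v))) 0 ≡ toℕ (f v))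
  (m : ℕ) (outdegree≤ : ∀ v → outdegree D v ≤ 2 + m)
  (s₀ s₁ s₂ s₃ s₄ s₅ s₆ : State) (blank : arr s₀ ≡ λ _ _ → 0)
  (e₁ : s₁ ≡ run D strip s₀) (e₂ : s₂ ≡ run D (sweeps m) s₁) (e₃ : s₃ ≡ run D cycles s₂)
  (e₄ : s₄ ≡ run D (sweep 1) s₃) (e₅ : s₅ ≡ run D (sweep 0) s₄) (e₆ : s₆ ≡ run D (peelings (3 + m)) s₅) where
  open Selection D f f-edge
  open Specs D f f-edge f-first
  open BreakingCycles D f f-edge
  open CycleSpecs D f f-edge f-first
  open PeelSpecs D f f-edge f-first
  open Distances D

  record SweptState (κ : Row) (k c : ℕ) (A : Arr) : Set where
    field
      colours : A colourA ≡ κ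
      stamped : Stamped (A stampA) (A clockA 0)
      swept   : Swept κ k (A stampA)
      clock   : A clockA 0 ≡ c

  kept : ∀ {k} {p : Prog k} {s s′} → s′ ≡ run D p s → ∀ b → touches b p ≡ false → arr s′ b ≡ arr s b
  kept {p = p} {s} refl b = frame D b p s

  sweep-swept : ∀ k s s′ κ → s′ ≡ run D (sweep k) s → arr s colourA ≡ κ → Stamped (arr s stampA) (arr s clockA 0) →
    (∀ (t : Fin n) → arr s stampA ! t ≢ 0 → k ≤ leaves κ t) → (∀ u → k < leaves κ u → Covered κ (arr s stampA) u) →
    SweptState κ k (arr s clockA 0 + n) (arr s′)
      × Sweeping κ k (arr s stampA) (arr s clockA 0) n (arr s′ stampA) (arr s′ clockA 0)
  sweep-swept k s _ κ refl refl st rich cov =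
    let sw = sweep-spec k s st rich cov
    in record { colours = frame D colourA (sweep k) s refl ; stamped = sw .Sweeping.stamped
              ; swept = sweeping-end sw ; clock = sw .Sweeping.clock } , sw

  sweeps-spec : ∀ m s s′ κ → s′ ≡ run D (sweeps m) s → arr s colourA ≡ κ → Stamped (arr s stampA) (arr s clockA 0) →
    (∀ (t : Fin n) → arr s stampA ! t ≢ 0 → 2 + m ≤ leaves κ t) → (∀ u → 2 + m < leaves κ u → Covered κ (arr s stampA) u) →
    SweptState κ 2 (arr s clockA 0 + suc m * n) (arr s′) × arr s′ selectedA ≡ arr s selectedA
  sweeps-spec zero s s′ κ e κ≡ st rich cov =
      subst (λ c → SweptState κ 2 (arr s clockA 0 + c) (arr s′)) (sym (+-identityʳ n)) (sweep-swept 2 s s′ κ e κ≡ st rich cov .proj₁)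
    , kept {p = sweep 2} e selectedA refl
  sweeps-spec (suc m) s s′ κ e κ≡ st rich cov = more (run D (sweep (3 + m)) s) refl e
    where
    more : ∀ t → t ≡ run D (sweep (3 + m)) s → s′ ≡ run D (sweeps m) t →
      SweptState κ 2 (arr s clockA 0 + suc (suc m) * n) (arr s′) × arr s′ selectedA ≡ arr s selectedA
    more t e e′ =
        subst (λ c → SweptState κ 2 c (arr s′)) (trans (cong (_+ suc m * n) clock) (+-assoc (arr s clockA 0) n (suc m * n))) (rest .proj₁)
      , trans (rest .proj₂) (kept {p = sweep (3 + m)} e selectedA refl)
      where
      open SweptState (sweep-swept (3 + m) s t κ e κ≡ st rich cov .proj₁)
      rest = sweeps-spec m t s′ κ e′ colours stamped (λ t t≢0 → <⇒≤ (swept .Swept.rich t t≢0)) (swept .Swept.covered)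

  κ₁ : Row
  κ₁ = arr s₁ colourA

  stripped : Consistent κ₁ × RootsOf (λ _ → ⊥) κ₁ × Stuck κ₁
  stripped = subst (λ s → let κ = arr s colourA in Consistent κ × RootsOf (λ _ → ⊥) κ × Stuck κ) (sym e₁)
    (strip-spec s₀ λ v → cong (λ a → a colourA ! v) blank)

  blank₁ : ∀ b → touches b strip ≡ false → arr s₁ b ≡ λ _ → 0
  blank₁ b untouched = trans (kept {p = strip} e₁ b untouched) (cong (λ a → a b) blank)

  clock₁ : arr s₁ clockA 0 ≡ 0
  clock₁ = cong (λ r → r 0) (blank₁ clockA refl)

  swept₂ : SweptState κ₁ 2 (arr s₁ clockA 0 + suc m * n) (arr s₂) × arr s₂ selectedA ≡ arr s₁ selectedA
  swept₂ = sweeps-spec m s₁ s₂ κ₁ e₂ refl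
    (subst₂ Stamped (sym (blank₁ stampA refl)) (sym clock₁) (record
      { bounded = λ _ → ≤-refl ; backward = λ u v u≢0 → ⊥-elim (u≢0 refl) ; distinct = λ u v u≢0 → ⊥-elim (u≢0 refl) }))
    (λ t t≢0 → ⊥-elim (t≢0 (cong (λ r → r ! t) (blank₁ stampA refl))))
    -- The descending sweeps may start at threshold d = 2 + m, since leaves are out-neighbours and
    -- no vertex has more than d of them.
    (λ u large → ⊥-elim (<⇒≱ large (≤-trans (leaves≤outdegree κ₁ u) (outdegree≤ u))))

  module S₂ = SweptState (swept₂ .proj₁)

  cycled : Cycling κ₁ (arr s₂ stampA) (arr s₂ clockA 0) n (arr s₃ colourA) (arr s₃ stampA) (arr s₃ clockA 0)
  cycled = subst₂ (λ κ s → Cycling κ (arr s₂ stampA) (arr s₂ clockA 0) n (arr s colourA) (arr s stampA) (arr s clockA 0))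
    S₂.colours (sym e₃)
    (cycles-spec s₂ (back Consistent (stripped .proj₁)) (back (RootsOf (λ _ → ⊥)) (stripped .proj₂ .proj₁))
      (back Stuck (stripped .proj₂ .proj₂)) S₂.stamped
      λ t t≢0 → back (λ κ → HasLeaf κ t) (leaves⇒HasLeaf κ₁ t (≤-trans (n≤1+n 1) (S₂.swept .Swept.rich t t≢0))))
    where
    back : (P : Row → Set) → P κ₁ → P (arr s₂ colourA)
    back P = subst P (sym S₂.colours)

  module C = Cycling cycled

  κ : Row
  κ = arr s₃ colourA

  swept₄ : SweptState κ 1 (arr s₃ clockA 0 + n) (arr s₄)
         × Sweeping κ 1 (arr s₃ stampA) (arr s₃ clockA 0) n (arr s₄ stampA) (arr s₄ clockA 0)
  swept₄ = sweep-swept 1 s₃ s₄ κ e₄ refl C.stamped (λ t t≢0 → HasLeaf⇒leaves κ (C.rich t t≢0))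
    (covered-after-cycles D f f-edge (stripped .proj₁) (stripped .proj₂ .proj₂) C.extendsκ C.extendsσ S₂.swept)

  module S₄ = SweptState (swept₄ .proj₁)

  swept₅ : SweptState κ 0 (arr s₄ clockA 0 + n) (arr s₅)
         × Sweeping κ 0 (arr s₄ stampA) (arr s₄ clockA 0) n (arr s₅ stampA) (arr s₅ clockA 0)
  swept₅ = sweep-swept 0 s₄ s₅ κ e₅ S₄.colours S₄.stamped (λ _ _ → z≤n) (S₄.swept .Swept.covered)

  module S₅ = SweptState (swept₅ .proj₁)

  clock₅ : arr s₅ clockA 0 ≡ (4 + m) * n
  clock₅ = trans S₅.clock (trans (cong (_+ n) S₄.clock) (trans (cong (λ c → c + n + n) (trans C.clock (cong (_+ n) (trans S₂.clock (cong (_+ suc m * n) clock₁))))) (collect m n)))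
    where
    open +-*-Solver
    collect : ∀ m n → suc m * n + n + n + n ≡ (4 + m) * n
    collect = solve 2 (λ m n → (con 1 :+ m) :* n :+ n :+ n :+ n := (con 4 :+ m) :* n) refl

  selected₅ : arr s₅ selectedA ≡ λ _ → 0
  selected₅ = trans (kept {p = sweep 0} e₅ selectedA refl) (trans (kept {p = sweep 1} e₄ selectedA refl)
    (trans (kept {p = cycles} e₃ selectedA refl) (trans (swept₂ .proj₂) (blank₁ selectedA refl))))

  σ q : Row
  σ = arr s₅ stampA
  q = arr s₆ selectedA

  -- The scan starts at the final clock, above which there is no stamp, and makes as many steps as
  -- the clock has ticked; it ends at 0, with every selected vertex decided.
  peeled : Peeling σ 0 q
  peeled = subst₂ (λ c s → Peeling σ c (arr s selectedA)) (trans (cong (_∸ (4 + m) * n) clock₅) (n∸n≡0 ((4 + m) * n))) (sym e₆)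
    (peelings-spec (3 + m) s₅ σ (arr s₅ clockA 0) (arr s₅ clockA 0) S₅.stamped
      (refl , peeling-start S₅.stamped (λ v → cong (λ r → r ! v) selected₅) , refl) .proj₂ .proj₁)

  Q : Subset n
  Q = output s₆

  Q⇒q : ∀ v → v ∈ Q → q ! v ≢ 0
  Q⇒q v v∈ z = contradiction (trans (sym z) (≡ᵇ⇒≡ (q ! v) 1 (T-≡ .Equivalence.from
    (trans (sym (lookup∘tabulate (λ v → q ! v ≡ᵇ 1) v)) ([]=⇒lookup v∈))))) λ ()

  q⇒Q : ∀ v → q ! v ≢ 0 → v ∈ Q
  q⇒Q v v≢0 = lookup⇒[]= v Q (trans (lookup∘tabulate (λ v → q ! v ≡ᵇ 1) v)
    (T-≡ .Equivalence.to (≡⇒≡ᵇ (q ! v) 1 (≤-antisym (peeled .Peeling.bit v) (n≢0⇒n>0 v≢0)))))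

  smallQuasiKernel : SmallQuasiKernel (2 + m) D Q
  smallQuasiKernel = Outcome.Verdict.smallQuasiKernel D f f-edge (2 + m) (s≤s (s≤s z≤n)) outdegree≤
    cycled (swept₄ .proj₂) (swept₅ .proj₂) peeled Q Q⇒q q⇒Q

-- Quadratic running time and the theorem

runTime : ℕ → ℕ → ℕ
runTime m n = coef (algorithm m) * suc n ^ 2

algorithm-finds : ∀ m → FindsSmallQuasiKernels (2 + m) (compile (algorithm m)) (runTime m)
algorithm-finds m n D inClass =
  let t , runs , bound = compile-runs D (algorithm m) initial
  in _ , t , runs , bound , Correctness.smallQuasiKernel D (proj₁ ∘ parents) (proj₂ ∘ proj₂ ∘ parents) (proj₁ ∘ proj₂ ∘ parents)
       m (λ v → ≤-trans (outdegree≤Δ⁺ D v) Δ⁺≤d) initial _ _ _ _ _ _ refl refl refl refl refl refl refl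
  where
  open InClass inClass
  parents = first-in-neighbour D sourceless

-- The factor 4 comes from (n + 1)² ≤ 4 n² for n ≥ 1. The threshold 1 is forced by n = 0, where the
-- time bound is positive and `n ^ 2` vanishes.
runTime-quadratic : ∀ m → runTime m ∈O (λ n → n ^ 2)
runTime-quadratic m = 4 * coef (algorithm m) , 1 , λ { (suc n) _ → begin
  coef (algorithm m) * (2 + n) ^ 2          ≤⟨ *-monoʳ-≤ (coef (algorithm m)) (doubled n) ⟩
  coef (algorithm m) * (4 * suc n ^ 2)      ≡⟨ sym (*-assoc (coef (algorithm m)) 4 (suc n ^ 2)) ⟩
  coef (algorithm m) * 4 * suc n ^ 2        ≡⟨ cong (_* suc n ^ 2) (*-comm (coef (algorithm m)) 4) ⟩
  4 * coef (algorithm m) * suc n ^ 2        ∎ }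
  where
  open ≤-Reasoning
  doubled : ∀ n → (2 + n) ^ 2 ≤ 4 * suc n ^ 2
  doubled n = m+n≤o⇒m≤o _ (≤-reflexive (square n))
    where
    open +-*-Solver
    square : ∀ n → (2 + n) ^ 2 + (3 * n ^ 2 + 4 * n) ≡ 4 * suc n ^ 2
    square = solve 1 (λ n → (con 2 :+ n) :^ 2 :+ (con 3 :* n :^ 2 :+ con 4 :* n) := con 4 :* (con 1 :+ n) :^ 2) refl

theorem1p5 : (d : ℕ) → 2 ≤ d →
    (∀ (n : ℕ) (D : Digraph n) → InClass d D → ∃[ Q ] SmallQuasiKernel d D Q)
    × (∃[ P ] ∃[ T ] T ∈O (λ n → n ^ 2) × FindsSmallQuasiKernels d P T)
theorem1p5 (suc zero) (s≤s ())
theorem1p5 (suc (suc m)) _ =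
    -- Existence is read off from the output of the algorithm.
    (λ n D inClass → let _ , _ , _ , _ , smallQ = algorithm-finds m n D inClass in _ , smallQ)
  , compile (algorithm m) , runTime m , runTime-quadratic m , algorithm-finds m
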